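{- For every $n\ge 2$ there is a bijection between $\mathcal S_n$ and the set of trees with vertex set $[n]=\{1,\dots,n\}$.
   Context: $\widetilde S_n$ is the affine symmetric group: the group of bijections $w:\mathbb Z\to\mathbb Z$ with $w(i+n)=w(i)+n$ and $\sum_{i=1}^n w(i)=\binom{n+1}{2}$, multiplied by composition. For $j\in\mathbb Z$, $s_j$ is the element interchanging $j+kn$ and $j+1+kn$ for all $k\in\mathbb Z$ (so $s_j$ depends on $j$ mod $n$). Let $\boldsymbol\lambda_n$ be the word $[s_0,s_1,\dots,s_{n-1}]$ repeated $n-1$ times, of length $n(n-1)$. A subword is a sequence $\mathsf u=[u_1,\dots,u_{n(n-1)}]$ where each $u_j$ is either the $j$-th letter of $\boldsymbol\lambda_n$ or the identity $e$ (a skip). $\mathcal S_n$ is the set of subwords with exactly $2n-2$ skips whose product $u_1u_2\cdots u_{n(n-1)}$ is the identity (the maximal distinguished subwords of $\boldsymbol\lambda_n$). -}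

module Defs where

open import Data.Bool using (Bool; true; false; if_then_else_)
open import Data.Nat using (ℕ; zero; suc; _*_; _∸_; _≤_; NonZero; _≡ᵇ_)
open import Data.Nat.DivMod using (_%_)
open import Data.Integer using (ℤ; _+_; _-_; 1ℤ)
open import Data.Integer.DivMod using (_%ℕ_)
open import Data.Fin using (Fin)
open import Data.Vec using (Vec; []; _∷_; lookup)
open import Data.List using (List; []; _∷_; length; _++_; [_])
open import Data.List.Relation.Unary.Linked using (Linked)
open import Data.List.Relation.Unary.Unique.Propositional using (Unique)
open import Data.Product using (Σ; _×_)
open import Relation.Binary.PropositionalEquality using (_≡_)
open import Relation.Nullary using (¬_)

-- The simple reflection s_j of the affine symmetric group (of rank n),
-- as a bijection ℤ → ℤ: it interchanges j + kn and j + 1 + kn for all k.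
-- (Depends on j only mod n.)  Meaningful for n ≥ 2.
s : (n : ℕ) → .{{NonZero n}} → (j : ℕ) → ℤ → ℤ
s n j x =
  if (x %ℕ n) ≡ᵇ (j % n) then x + 1ℤ
  else if (x %ℕ n) ≡ᵇ (suc j % n) then x - 1ℤ
  else x

-- A subword of λ_n = [s_0,…,s_{n-1}]^(n-1) is recorded by a vector of
-- n(n-1) booleans: entry at position p (0-indexed) is true if u_{p+1} is
-- the p-th letter of λ_n, namely s_{p mod n}, and false if it is a skip e.
wordLength : ℕ → ℕ
wordLength n = n * (n ∸ 1)

Subword : ℕ → Set
Subword n = Vec Bool (wordLength n)

letter : (n : ℕ) → .{{NonZero n}} → ℕ → Bool → ℤ → ℤ
letter n p true  x = s n p x
letter n p false x = x

prodFrom : (n : ℕ) → .{{NonZero n}} → ℕ → {m : ℕ} → Vec Bool m → ℤ → ℤ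
prodFrom n p []       x = x
prodFrom n p (b ∷ bs) x = letter n p b (prodFrom n (suc p) bs x)

product : (n : ℕ) → .{{NonZero n}} → Subword n → ℤ → ℤ
product n u = prodFrom n 0 u

skips : {m : ℕ} → Vec Bool m → ℕ
skips []           = 0
skips (true  ∷ bs) = skips bs
skips (false ∷ bs) = suc (skips bs)

-- 𝒮_n: subwords with exactly 2n-2 skips whose product is the identity.
-- Proof fields are irrelevant, so two elements are equal iff the
-- underlying subwords are equal.
record MaxDistSubword (n : ℕ) .{{_ : NonZero n}} : Set where
  constructor mkSub
  field
    word : Subword n
    .skipCount : skips word ≡ 2 * n ∸ 2
    .isIdentity : (x : ℤ) → product n word x ≡ x

Adj : {n : ℕ} → Vec (Vec Bool n) n → Fin n → Fin n → Set
Adj A i j = lookup (lookup A i) j ≡ true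

data Walk {n : ℕ} (A : Vec (Vec Bool n) n) : Fin n → Fin n → Set where
  here : ∀ {i} → Walk A i i
  step : ∀ {i j k} → Adj A i j → Walk A j k → Walk A i k

Connected : {n : ℕ} → Vec (Vec Bool n) n → Set
Connected A = ∀ i j → Walk A i j

IsCycle : {n : ℕ} → Vec (Vec Bool n) n → List (Fin n) → Set
IsCycle A []       = Data.Empty.⊥ where import Data.Empty
IsCycle A (v ∷ vs) =
  3 ≤ length (v ∷ vs) × Unique (v ∷ vs) × Linked (Adj A) ((v ∷ vs) ++ [ v ])

Acyclic : {n : ℕ} → Vec (Vec Bool n) n → Set
Acyclic {n} A = ¬ Σ (List (Fin n)) (IsCycle A)

-- A tree with vertex set [n]: a simple graph (symmetric, loopless
-- adjacency matrix) that is connected and acyclic.  Proof fields are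
-- irrelevant, so trees are equal iff their edge sets are equal.
record LabelledTree (n : ℕ) : Set where
  constructor mkTree
  field
    adj : Vec (Vec Bool n) n
    .symmetric : ∀ i j → lookup (lookup adj i) j ≡ lookup (lookup adj j) i
    .loopless : ∀ i → lookup (lookup adj i) i ≡ false
    .connected : Connected adj
    .acyclic : Acyclic adj

{-# OPTIONS --safe #-}
module Submission where

open import Defs
open import Data.Bool using (Bool; true; false; if_then_else_; not)
import Data.Bool.Properties as Bool
open import Data.Empty using (⊥; ⊥-elim)
open import Data.Fin using (Fin; zero; suc; toℕ; fromℕ; fromℕ<; inject₁; combine; remQuot)
import Data.Fin.Properties as Fin
open import Data.Fin.Permutation.Components using (transpose)
open import Data.Fin.Induction using (<-weakInduction; >-weakInduction)
open import Data.Integer using (ℤ)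
import Data.Integer as ℤ
import Data.Integer.Properties as ℤ
open import Data.Integer.DivMod using (_%ℕ_)
import Data.Integer.DivMod as ℤ
open import Data.Integer.Tactic.RingSolver using (solve-∀)
open import Data.List using (List; []; _∷_; _++_; [_])
open import Data.List.Membership.Propositional using (_∈_)
import Data.List.Membership.DecPropositional as DecMembership
open import Data.List.Relation.Unary.All using (All; []; _∷_)
open import Data.List.Relation.Unary.All.Properties using (¬Any⇒All¬)
open import Data.List.Relation.Unary.AllPairs using ([]; _∷_)
open import Data.List.Relation.Unary.Any using (here; there)
open import Data.List.Relation.Unary.Linked using (Linked; [-]; _∷_)
open import Data.List.Relation.Unary.Unique.Propositional using (Unique)
open import Data.Nat using (ℕ; zero; suc; _+_; _*_; _∸_; _≤_; _<_; _≡ᵇ_; z≤n; s≤s; NonZero)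
open import Data.Nat.DivMod using (_%_)
import Data.Nat.DivMod as ℕ
open import Data.Nat.Induction using (Acc; acc; <-wellFounded)
open import Data.Nat.Properties as ℕ using (_≟_; anyUpTo?)
open import Data.Product as Product using (∃; _×_; _,_; proj₁; proj₂; map₂; swap; uncurry)
import Data.Product.Properties as Product
open import Data.Sum as Sum using (_⊎_; inj₁; inj₂)
open import Data.Unit using (⊤; tt)
open import Data.Vec using (Vec; []; _∷_; lookup; tabulate)
open import Data.Vec.Properties as Vec using (lookup∘tabulate; tabulate∘lookup; tabulate-cong)
open import Function using (_∘_)
open import Function.Bundles using (_⤖_; mk⇔; mk⤖)
open import Relation.Binary.PropositionalEquality hiding ([_])
open import Relation.Nullary using (¬_; Dec; yes; no; does; contradiction)
open import Relation.Nullary.Decidable using (_×-dec_; decidable-stable; dec-true; dec-false; does-⇔; _⊎-dec_; recompute)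
open import Relation.Binary.Definitions using (tri<; tri≈; tri>)
open import Algebra.Properties.CommutativeMonoid.Sum ℕ.+-0-commutativeMonoid
  using (sum; sum-cong-≗; sum-replicate-zero; ∑-distrib-+)
import Algebra.Properties.AbelianGroup ℤ.+-0-abelianGroup as ℤ+

-- Write n = m + 1 and read the word from its right end.  The letters let a hand, which holds
-- one of n objects, go round m slots holding the other ones: a taken letter passes the
-- current slot, a skipped letter exchanges its content with the hand.  The product is
-- the identity iff the final arrangement is the initial one and every object has been met in a
-- slot exactly m times.  The tree of a word joins the two objects of every exchange.
--
-- In a word of 𝒮_n every slot is used exactly twice, so that it contains its own object or
-- one further object, the parent.  Every slot receives an object as often as it gives
-- it away, so the number of meetings of object h with slot s does not depend on s; these
-- numbers are positive and add up to n over h, hence are all 1.  It follows that objects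
-- adjacent in the tree are exchanged whenever they meet, so the tree determines the word.
--
-- Conversely, exchanging whenever the met object is adjacent in a given tree moves the hand by
-- the transposition of the edge belonging to the slot.  The product of these transpositions is
-- an n-cycle, so the hand meets every slot with every object exactly once.

-- Sums and counting

⟦_⟧ : {A : Set} → Dec A → ℕ
⟦ yes _ ⟧ = 1
⟦ no _ ⟧ = 0

⟦⟧-yes : {A : Set} (d : Dec A) → A → ⟦ d ⟧ ≡ 1
⟦⟧-yes (yes _) a = refl
⟦⟧-yes (no ¬a) a = contradiction a ¬a

⟦⟧-no : {A : Set} (d : Dec A) → ¬ A → ⟦ d ⟧ ≡ 0
⟦⟧-no (yes a) ¬a = contradiction a ¬a
⟦⟧-no (no _) ¬a = refl

⟦⟧-cong : {A B : Set} (a? : Dec A) (b? : Dec B) → (A → B) → (B → A) → ⟦ a? ⟧ ≡ ⟦ b? ⟧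
⟦⟧-cong (yes a) b? f g = sym (⟦⟧-yes b? (f a))
⟦⟧-cong (no ¬a) b? f g = sym (⟦⟧-no b? (¬a ∘ g))

⟦⟧-⊎ : {A B : Set} (a? : Dec A) (b? : Dec B) → ¬ (A × B) →
       ⟦ a? ⊎-dec b? ⟧ ≡ ⟦ a? ⟧ + ⟦ b? ⟧
⟦⟧-⊎ (yes a) (yes b) ¬ab = contradiction (a , b) ¬ab
⟦⟧-⊎ (yes a) (no ¬b) ¬ab = refl
⟦⟧-⊎ (no ¬a) (yes b) ¬ab = refl
⟦⟧-⊎ (no ¬a) (no ¬b) ¬ab = refl

∑< : ℕ → (ℕ → ℕ) → ℕ
∑< zero    f = 0
∑< (suc n) f = f n + ∑< n f

∑<-cong : ∀ n {f g} → (∀ i → i < n → f i ≡ g i) → ∑< n f ≡ ∑< n g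
∑<-cong zero    eq = refl
∑<-cong (suc n) eq = cong₂ _+_ (eq n ℕ.≤-refl) (∑<-cong n λ i → eq i ∘ ℕ.m<n⇒m<1+n)

∑<-+ : ∀ n f g → ∑< n (λ i → f i + g i) ≡ ∑< n f + ∑< n g
∑<-+ zero    f g = refl
∑<-+ (suc n) f g = begin
  (f n + g n) + ∑< n (λ i → f i + g i)  ≡⟨ cong (f n + g n +_) (∑<-+ n f g) ⟩
  (f n + g n) + (∑< n f + ∑< n g)       ≡⟨ interchange (f n) (g n) _ _ ⟩
  (f n + ∑< n f) + (g n + ∑< n g)       ∎
  where
  open ≡-Reasoning
  open import Algebra.Properties.CommutativeSemigroup ℕ.+-commutativeSemigroup

-- Subtraction-free form of a telescoping sum: `c` acts as a potential whose drop at step `i` is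
-- `f i - g i`.
∑<-telescope : ∀ n {f g} (c : ℕ → ℕ) → (∀ i → i < n → f i + c (suc i) ≡ g i + c i) →
               ∑< n f + c n ≡ ∑< n g + c 0
∑<-telescope zero c eq = refl
∑<-telescope (suc n) {f} {g} c eq = begin
  (f n + ∑< n f) + c (suc n)  ≡⟨ xy∙z≈xz∙y (f n) _ _ ⟩
  (f n + c (suc n)) + ∑< n f  ≡⟨ cong (_+ ∑< n f) (eq n ℕ.≤-refl) ⟩
  (g n + c n) + ∑< n f        ≡⟨ xy∙z≈x∙zy (g n) _ _ ⟩
  g n + (∑< n f + c n)        ≡⟨ cong (g n +_) (∑<-telescope n c λ i → eq i ∘ ℕ.m<n⇒m<1+n) ⟩
  g n + (∑< n g + c 0)        ≡⟨ ℕ.+-assoc (g n) _ _ ⟨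
  (g n + ∑< n g) + c 0        ∎
  where
  open ≡-Reasoning
  open import Algebra.Properties.CommutativeSemigroup ℕ.+-commutativeSemigroup

∑<-shift : ∀ n f → f n ≡ f 0 → ∑< n (f ∘ suc) ≡ ∑< n f
∑<-shift n f eq = ℕ.+-cancelʳ-≡ (f 0) _ _ (begin
  ∑< n (f ∘ suc) + f 0  ≡⟨ ∑<-telescope n f (λ i _ → ℕ.+-comm (f i) _) ⟨
  ∑< n f + f n          ≡⟨ cong (∑< n f +_) eq ⟩
  ∑< n f + f 0          ∎)
  where open ≡-Reasoning

∑<-one : ∀ n → ∑< n (λ _ → 1) ≡ n
∑<-one zero    = refl
∑<-one (suc n) = cong suc (∑<-one n)

term≤∑< : ∀ {n i} f → i < n → f i ≤ ∑< n f
term≤∑< {suc n} {i} f (s≤s i≤n) with ℕ.m≤n⇒m<n∨m≡n i≤n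
... | inj₁ i<n  = ℕ.≤-trans (term≤∑< f i<n) (ℕ.m≤n+m _ (f n))
... | inj₂ refl = ℕ.m≤m+n (f n) _

module _ {P : ℕ → Set} (P? : ∀ i → Dec (P i)) where

  count : ℕ → ℕ
  count n = ∑< n (λ i → ⟦ P? i ⟧)

  count-none : ∀ n → (∀ i → i < n → ¬ P i) → count n ≡ 0
  count-none zero    ¬P = refl
  count-none (suc n) ¬P = cong₂ _+_ (⟦⟧-no (P? n) (¬P n ℕ.≤-refl)) (count-none n λ i → ¬P i ∘ ℕ.m<n⇒m<1+n)

  count-one : ∀ {n i} → i < n → P i → (∀ j → j < n → P j → i ≡ j) → count n ≡ 1
  count-one {suc n} {i} (s≤s i≤n) Pi unique with ℕ.m≤n⇒m<n∨m≡n i≤n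
  ... | inj₁ i<n  = cong₂ _+_
                      (⟦⟧-no (P? n) λ Pn → ℕ.<⇒≢ i<n (unique n ℕ.≤-refl Pn))
                      (count-one i<n Pi λ j → unique j ∘ ℕ.m<n⇒m<1+n)
  ... | inj₂ refl = cong₂ _+_
                      (⟦⟧-yes (P? i) Pi)
                      (count-none i λ j j<i Pj → ℕ.<⇒≢ j<i (sym (unique j (ℕ.m<n⇒m<1+n j<i) Pj)))

  count≥1 : ∀ {n i} → i < n → P i → 1 ≤ count n
  count≥1 {i = i} i<n Pi = ℕ.≤-trans (ℕ.≤-reflexive (sym (⟦⟧-yes (P? i) Pi))) (term≤∑< (λ j → ⟦ P? j ⟧) i<n)

  count≥2 : ∀ {n i j} → i < j → j < n → P i → P j → 2 ≤ count n
  count≥2 {suc n} {i} {j} i<j (s≤s j≤n) Pi Pj with ℕ.m≤n⇒m<n∨m≡n j≤n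
  ... | inj₁ j<n  = ℕ.≤-trans (count≥2 i<j j<n Pi Pj) (ℕ.m≤n+m _ ⟦ P? n ⟧)
  ... | inj₂ refl = ℕ.+-mono-≤ (ℕ.≤-reflexive (sym (⟦⟧-yes (P? j) Pj))) (count≥1 i<j Pi)

  count≡1⇒unique : ∀ {n i j} → count n ≡ 1 → i < n → j < n → P i → P j → i ≡ j
  count≡1⇒unique {n} {i} {j} eq i<n j<n Pi Pj with ℕ.<-cmp i j
  ... | tri< i<j _ _ = contradiction (subst (2 ≤_) eq (count≥2 i<j j<n Pi Pj)) λ { (s≤s ()) }
  ... | tri≈ _ i≡j _ = i≡j
  ... | tri> _ _ j<i = contradiction (subst (2 ≤_) eq (count≥2 j<i i<n Pj Pi)) λ { (s≤s ()) }

  count-mono : ∀ {i j} → i ≤ j → count i ≤ count j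
  count-mono {j = j} z≤n = z≤n
  count-mono {i} {suc j} i≤1+j with ℕ.m≤n⇒m<n∨m≡n i≤1+j
  ... | inj₁ (s≤s i≤j) = ℕ.≤-trans (count-mono i≤j) (ℕ.m≤n+m _ ⟦ P? j ⟧)
  ... | inj₂ refl      = ℕ.≤-refl

  count-yes : ∀ {i} → P i → count (suc i) ≡ suc (count i)
  count-yes {i} Pi = cong (_+ count i) (⟦⟧-yes (P? i) Pi)

  -- The count rises by at most one per index, so it cannot jump over `r`.
  count-reaches : ∀ {r} n → r < count n → ∃ λ i → i < n × count i ≡ r × P i
  count-reaches {r} (suc n) r<c with ℕ.<-cmp r (count n)
  ... | tri< r<cn _ _ = let (i , i<n , rest) = count-reaches n r<cn in i , ℕ.m<n⇒m<1+n i<n , rest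
  ... | tri> _ _ cn<r = contradiction r<c (ℕ.≤⇒≯ (ℕ.≤-trans (ℕ.+-monoˡ-≤ _ (⟦⟧≤1 (P? n))) cn<r))
    where
    ⟦⟧≤1 : {A : Set} (d : Dec A) → ⟦ d ⟧ ≤ 1
    ⟦⟧≤1 (yes _) = ℕ.≤-refl
    ⟦⟧≤1 (no _)  = z≤n
  ... | tri≈ _ refl _ with P? n
  ...   | yes Pn = n , ℕ.≤-refl , refl , Pn
  ...   | no _   = contradiction r<c ℕ.1+n≰n

∑<-sum : ∀ n {k} (g : ℕ → Fin k → ℕ) →
         ∑< n (λ i → sum (g i)) ≡ sum (λ s → ∑< n (λ i → g i s))
∑<-sum zero    {k} g = sym (sum-replicate-zero k)
∑<-sum (suc n) g = trans (cong (sum (g n) +_) (∑<-sum n g)) (sym (∑-distrib-+ (g n) _))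

sum-const : ∀ k c → sum {k} (λ _ → c) ≡ k * c
sum-const zero    c = refl
sum-const (suc k) c = cong (c +_) (sum-const k c)

sum-zero : ∀ {k} {f : Fin k → ℕ} → (∀ s → f s ≡ 0) → sum f ≡ 0
sum-zero {zero}  f≡0 = refl
sum-zero {suc k} f≡0 = cong₂ _+_ (f≡0 zero) (sum-zero (f≡0 ∘ suc))

sum-mono : ∀ {k} {f g : Fin k → ℕ} → (∀ s → f s ≤ g s) → sum f ≤ sum g
sum-mono {zero}  f≤g = z≤n
sum-mono {suc k} f≤g = ℕ.+-mono-≤ (f≤g zero) (sum-mono (f≤g ∘ suc))

term≤sum : ∀ {k} (f : Fin k → ℕ) s → f s ≤ sum f
term≤sum f zero    = ℕ.m≤m+n (f zero) _
term≤sum f (suc s) = ℕ.≤-trans (term≤sum (f ∘ suc) s) (ℕ.m≤n+m _ (f zero))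

-- Once the total is as small as the lower bounds allow, no term has any slack. This turns
-- inequalities for single slots or objects into equations.
sum-squeeze : ∀ {k c} (f : Fin k → ℕ) → (∀ s → c ≤ f s) → sum f ≡ k * c → ∀ s → f s ≡ c
sum-squeeze {suc k} {c} f c≤f eq = λ
  { zero    → ℕ.≤-antisym f₀≤c (c≤f zero)
  ; (suc s) → sum-squeeze (f ∘ suc) (c≤f ∘ suc) (ℕ.+-cancelˡ-≡ c _ _
                (trans (cong (_+ sum (f ∘ suc)) (ℕ.≤-antisym (c≤f zero) f₀≤c)) eq)) s }
  where
  f₀≤c : f zero ≤ c
  f₀≤c = ℕ.+-cancelʳ-≤ (k * c) _ _ (begin
    f zero + k * c                ≡⟨ cong (f zero +_) (sum-const k c) ⟨
    f zero + sum {k} (λ _ → c)    ≤⟨ ℕ.+-monoʳ-≤ (f zero) (sum-mono (c≤f ∘ suc)) ⟩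
    f zero + sum (f ∘ suc)        ≡⟨ eq ⟩
    c + k * c                     ∎)
    where open ℕ.≤-Reasoning

sum-⟦≟⟧ : ∀ {k} (s : Fin k) → sum (λ t → ⟦ s Fin.≟ t ⟧) ≡ 1
sum-⟦≟⟧ {suc k} zero = cong suc (sum-zero {k} λ t → ⟦⟧-no (zero Fin.≟ suc t) λ ())
sum-⟦≟⟧ (suc s) = trans
  (sum-cong-≗ λ t → ⟦⟧-cong (suc s Fin.≟ suc t) (s Fin.≟ t) Fin.suc-injective (cong suc))
  (sum-⟦≟⟧ s)

-- Lets a count of times be split according to the slot met or the object held, since exactly one
-- `t` equals `s`.
sum-×≟ : ∀ {k} {A : Set} (a? : Dec A) (s : Fin k) → sum (λ t → ⟦ a? ×-dec s Fin.≟ t ⟧) ≡ ⟦ a? ⟧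
sum-×≟ (yes a) s = trans
  (sum-cong-≗ λ t → ⟦⟧-cong (yes a ×-dec s Fin.≟ t) (s Fin.≟ t) proj₂ (a ,_))
  (sum-⟦≟⟧ s)
sum-×≟ (no ¬a) s = sum-zero λ t → ⟦⟧-no (no ¬a ×-dec s Fin.≟ t) (¬a ∘ proj₁)

-- Trees as parent functions

-- Trees on Fin (suc m) rooted at zero: q s is the parent of suc s.
module Edges {m} (q : Fin m → Fin (suc m)) where

  infix 4 _↓_ _—_

  _↓_ : Fin (suc m) → Fin (suc m) → Set
  u ↓ v = ∃ λ s → u ≡ q s × v ≡ suc s

  _—_ : Fin (suc m) → Fin (suc m) → Set
  u — v = u ↓ v ⊎ v ↓ u

  _↓?_ : ∀ u v → Dec (u ↓ v)
  u ↓? v = Fin.any? λ s → u Fin.≟ q s ×-dec v Fin.≟ suc s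

  _—?_ : ∀ u v → Dec (u — v)
  u —? v = u ↓? v ⊎-dec v ↓? u

  —-sym : ∀ {u v} → u — v → v — u
  —-sym (inj₁ d) = inj₂ d
  —-sym (inj₂ d) = inj₁ d

  ↓-unique : ∀ {u u′ v} → u ↓ v → u′ ↓ v → u ≡ u′
  ↓-unique (s , refl , refl) (s′ , refl , eq) = cong q (Fin.suc-injective eq)

  -- A rank growing from parent to child expresses that iterating `q` always ends at the root. It
  -- will be the distance to the root for a tree, and the time of the first exchange for a word.
  record Ranked : Set where
    field
      rank   : Fin m → ℕ
      rank-< : ∀ {s t} → q s ≡ suc t → rank t < rank s

    level : Fin (suc m) → ℕ
    level zero    = 0
    level (suc s) = suc (rank s)

    ↓-level : ∀ {u v} → u ↓ v → level u < level v
    ↓-level (s , refl , refl) with q s in eq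
    ... | zero  = s≤s z≤n
    ... | suc t = s≤s (rank-< eq)

    -- Ranks increase from parents to children but stay below their sum.
    children-induction : {P : Fin m → Set} → (∀ s → (∀ t → q t ≡ suc s → P t) → P s) → ∀ s → P s
    children-induction {P} node s = go s (<-wellFounded _)
      where
      go : ∀ s → Acc _<_ (sum rank ∸ rank s) → P s
      go s (acc rs) = node s λ t eq → go t (rs (ℕ.∸-monoʳ-< (rank-< eq) (term≤sum rank t)))

    parent-induction : {P : Fin (suc m) → Set} → P zero → (∀ s → P (q s) → P (suc s)) → ∀ v → P v
    parent-induction {P} root node v = go v (<-wellFounded _)
      where
      go : ∀ v → Acc _<_ (level v) → P v
      go zero    _        = root
      go (suc s) (acc rs) = node s (go (q s) (rs (↓-level (s , refl , refl))))

    ↓-irrefl : ∀ {u} → ¬ (u ↓ u)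
    ↓-irrefl d = ℕ.<-irrefl refl (↓-level d)

-- The tree of a ranked parent function

Matrix : ℕ → Set
Matrix n = Vec (Vec Bool n) n

module _ {n} {A : Matrix n} where

  _◅◅_ : ∀ {i j k} → Walk A i j → Walk A j k → Walk A i k
  here     ◅◅ w′ = w′
  step a w ◅◅ w′ = step a (w ◅◅ w′)

module ParentToTree {m} {q : Fin m → Fin (suc m)} (ranked : Edges.Ranked q) {A : Matrix (suc m)}
  (from-edge : ∀ {u v} → Edges._—_ q u v → Adj A u v)
  (to-edge : ∀ {u v} → Adj A u v → Edges._—_ q u v) where

  open Edges q
  open Ranked ranked

  symmetric : ∀ u v → lookup (lookup A u) v ≡ lookup (lookup A v) u
  symmetric u v with lookup (lookup A u) v in uv | lookup (lookup A v) u in vu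
  ... | true  | true  = refl
  ... | false | false = refl
  ... | true  | false = trans (sym (from-edge (—-sym (to-edge uv)))) vu
  ... | false | true  = trans (sym uv) (from-edge (—-sym (to-edge vu)))

  loopless : ∀ u → lookup (lookup A u) u ≡ false
  loopless u with lookup (lookup A u) u in uu
  ... | false = refl
  ... | true with to-edge uu
  ...   | inj₁ d = contradiction d ↓-irrefl
  ...   | inj₂ d = contradiction d ↓-irrefl

  walks : ∀ u → Walk A u zero × Walk A zero u
  walks = parent-induction (here , here) λ s (w , w′) →
    step (from-edge (inj₂ (s , refl , refl))) w , w′ ◅◅ step (from-edge (inj₁ (s , refl , refl))) here

  connected : Connected A
  connected u v = proj₁ (walks u) ◅◅ proj₂ (walks v)

  NonBacktracking : List (Fin (suc m)) → Set
  NonBacktracking (x ∷ y ∷ z ∷ zs) = x ≢ z × NonBacktracking (y ∷ z ∷ zs)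
  NonBacktracking _                = ⊤

  unique⇒nonBacktracking : ∀ {v xs} → All (v ≢_) xs → Unique xs → NonBacktracking (xs ++ [ v ])
  unique⇒nonBacktracking {xs = []}             _            _ = tt
  unique⇒nonBacktracking {xs = x ∷ []}         _            _ = tt
  unique⇒nonBacktracking {xs = x ∷ y ∷ []}     (v≢x ∷ _)    _ = ≢-sym v≢x , tt
  unique⇒nonBacktracking {xs = x ∷ y ∷ z ∷ zs} (_ ∷ v≢yzs) ((_ ∷ x≢z ∷ _) ∷ u) =
    x≢z , unique⇒nonBacktracking v≢yzs u

  final : Fin (suc m) → List (Fin (suc m)) → Fin (suc m)
  final y []       = y
  final y (z ∷ zs) = final z zs

  final-∈ : ∀ {P : Fin (suc m) → Set} {y} zs → All P (y ∷ zs) → P (final y zs)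
  final-∈ []       (p ∷ _)  = p
  final-∈ (z ∷ zs) (_ ∷ ps) = final-∈ zs ps

  -- A non-backtracking walk that once moves away from the root does so for ever.
  descends : ∀ {x y v} zs → x ↓ y → Linked (Adj A) (y ∷ zs ++ [ v ]) →
             NonBacktracking (x ∷ y ∷ zs ++ [ v ]) → level x < level v
  descends {y = y} {v} [] x↓y (a ∷ _) (x≢v , _) with to-edge a
  ... | inj₁ y↓v = ℕ.<-trans (↓-level x↓y) (↓-level y↓v)
  ... | inj₂ v↓y = contradiction (↓-unique x↓y v↓y) x≢v
  descends (z ∷ zs) x↓y (a ∷ as) (x≢z , nb) with to-edge a
  ... | inj₁ y↓z = ℕ.<-trans (↓-level x↓y) (descends zs y↓z as nb)
  ... | inj₂ z↓y = contradiction (↓-unique x↓y z↓y) x≢z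

  -- Proved from the far end: a descent followed by an ascent would return to the same parent, so an
  -- ascending last step forces all earlier steps to ascend.
  ascends-or-ends-descending : ∀ {x y v} zs → Linked (Adj A) (x ∷ y ∷ zs ++ [ v ]) →
    NonBacktracking (x ∷ y ∷ zs ++ [ v ]) →
    (y ↓ x × level v < level x) ⊎ final y zs ↓ v
  ascends-or-ends-descending [] (a ∷ b ∷ _) (x≢v , _) with to-edge a | to-edge b
  ... | _        | inj₁ y↓v = inj₂ y↓v
  ... | inj₁ x↓y | inj₂ v↓y = contradiction (↓-unique x↓y v↓y) x≢v
  ... | inj₂ y↓x | inj₂ v↓y = inj₁ (y↓x , ℕ.<-trans (↓-level v↓y) (↓-level y↓x))
  ascends-or-ends-descending (z ∷ zs) (a ∷ as) (x≢z , nb)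
    with ascends-or-ends-descending zs as nb | to-edge a
  ... | inj₂ end         | _        = inj₂ end
  ... | inj₁ (z↓y , _)   | inj₁ x↓y = contradiction (↓-unique x↓y z↓y) x≢z
  ... | inj₁ (z↓y , v<y) | inj₂ y↓x = inj₁ (y↓x , ℕ.<-trans v<y (↓-level y↓x))

  -- A cycle that starts downwards, or ascends throughout, would change the level of its base point.
  -- Otherwise it leaves `v` for its parent and also comes back from it, repeating that vertex.
  acyclic : Acyclic A
  acyclic (v ∷ [] , s≤s () , _)
  acyclic (v ∷ a ∷ [] , s≤s (s≤s ()) , _)
  acyclic (v ∷ a ∷ b ∷ zs , _ , v≢@(_ ∷ v≢b ∷ _) ∷ u@(a≢ ∷ _) , link@(va ∷ link′))
    with to-edge va | ascends-or-ends-descending (b ∷ zs) link (v≢b , unique⇒nonBacktracking v≢ u)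
  ... | inj₁ v↓a | _              = ℕ.<-irrefl refl (descends (b ∷ zs) v↓a link′ (v≢b , unique⇒nonBacktracking v≢ u))
  ... | inj₂ _   | inj₁ (_ , v<v) = ℕ.<-irrefl refl v<v
  ... | inj₂ a↓v | inj₂ end↓v     = final-∈ zs a≢ (↓-unique a↓v end↓v)

-- Loop erasure and the parent function of a given tree

data Chain {n} (R : Fin n → Fin n → Set) : Fin n → List (Fin n) → Fin n → Set where
  nil  : ∀ {u} → Chain R u (u ∷ []) u
  cons : ∀ {u w v l} → R u w → Chain R w l v → Chain R u (u ∷ l) v

module _ {n} {R : Fin n → Fin n → Set} where

  data Star : Fin n → Fin n → Set where
    ε   : ∀ {u} → Star u u
    _◂_ : ∀ {u w v} → R u w → Star w v → Star u v

  _◂◂_ : ∀ {i j k} → Star i j → Star j k → Star i k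
  ε       ◂◂ w′ = w′
  (a ◂ w) ◂◂ w′ = a ◂ (w ◂◂ w′)

  drop-until : ∀ {u w v l} → Chain R w l v → Unique l → u ∈ l → ∃ λ l′ → Chain R u l′ v × Unique l′
  drop-until nil        uniq       (here refl) = _ , nil , uniq
  drop-until (cons r c) uniq       (here refl) = _ , cons r c , uniq
  drop-until (cons r c) (_ ∷ uniq) (there u∈)  = drop-until c uniq u∈

  loop-erase : ∀ {u v} → Star u v → ∃ λ l → Chain R u l v × Unique l
  loop-erase {u} ε = _ , nil , [] ∷ []
  loop-erase {u} (r ◂ w) with loop-erase w
  ... | l , c , uniq with DecMembership._∈?_ Fin._≟_ u l
  ...   | yes u∈l = drop-until c uniq u∈l
  ...   | no  u∉l = _ , cons r c , ¬Any⇒All¬ _ u∉l ∷ uniq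

  close : ∀ {S : Fin n → Fin n → Set} {u v w l} → (∀ {x y} → R x y → S x y) →
          Chain R u l v → S v w → Linked S (l ++ [ w ])
  close R⇒S nil                   vw = vw ∷ [-]
  close R⇒S (cons r nil)          vw = R⇒S r ∷ vw ∷ [-]
  close R⇒S (cons r c@(cons _ _)) vw = R⇒S r ∷ close R⇒S c vw

  -- Unless the loop-erased route is the single edge from `u` to `v`, it has at least three
  -- vertices, and the edge from `v` back to `u` closes it to a cycle.
  no-second-route : ∀ {A : Matrix n} → Acyclic A → (∀ {x y} → R x y → Adj A x y) →
                    ∀ {u v} → Star u v → u ≢ v → Adj A v u → ¬ ¬ R u v
  no-second-route acyclic R⇒A w u≢v vu ¬uv with loop-erase w
  ... | _ , nil , _                            = u≢v refl
  ... | _ , cons r nil , _                     = ¬uv r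
  ... | _ , c@(cons _ (cons _ nil)) , uniq     = acyclic (_ , s≤s (s≤s (s≤s z≤n)) , uniq , close R⇒A c vu)
  ... | _ , c@(cons _ (cons _ (cons _ _))) , uniq = acyclic (_ , s≤s (s≤s (s≤s z≤n)) , uniq , close R⇒A c vu)

least : {P : ℕ → Set} → (∀ k → Dec (P k)) → ∀ k → P k → ∃ λ d → P d × (∀ j → P j → d ≤ j)
least P? zero    p = zero , p , λ _ _ → z≤n
least P? (suc k) p with P? zero
... | yes p₀ = zero , p₀ , λ _ _ → z≤n
... | no ¬p₀ with least (P? ∘ suc) k p
...   | d , pd , min = suc d , pd , λ { zero p₀ → contradiction p₀ ¬p₀ ; (suc j) pj → s≤s (min j pj) }

module TreeToParent {m} {A : Matrix (suc m)}
  (symmetric : ∀ i j → lookup (lookup A i) j ≡ lookup (lookup A j) i)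
  (loopless : ∀ i → lookup (lookup A i) i ≡ false)
  (connected : Connected A) (acyclic : Acyclic A) where

  Reach : ℕ → Fin (suc m) → Set
  Reach zero    v = v ≡ zero
  Reach (suc k) v = ∃ λ w → Adj A v w × Reach k w

  reach? : ∀ k v → Dec (Reach k v)
  reach? zero    v = v Fin.≟ zero
  reach? (suc k) v = Fin.any? λ w → lookup (lookup A v) w Bool.≟ true ×-dec reach? k w

  walk⇒reach : ∀ {v} → Walk A v zero → ∃ λ k → Reach k v
  walk⇒reach here       = zero , refl
  walk⇒reach (step a w) = let (k , r) = walk⇒reach w in suc k , _ , a , r

  nearest : ∀ v → ∃ λ d → Reach d v × (∀ j → Reach j v → d ≤ j)
  nearest v = let (k , r) = walk⇒reach (connected v zero) in least (λ k → reach? k v) k r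

  distance : Fin (suc m) → ℕ
  distance v = proj₁ (nearest v)

  -- The first step of a shortest walk to the root leaves a walk that is shorter by one.
  closer : ∀ s → ∃ λ w → Adj A (suc s) w × distance w < distance (suc s)
  closer s with nearest (suc s)
  ... | suc d , (w , a , r) , _ = w , a , s≤s (proj₂ (proj₂ (nearest w)) d r)

  parent : Fin m → Fin (suc m)
  parent s = proj₁ (closer s)

  open Edges parent

  ranked : Ranked
  ranked = record
    { rank   = λ s → distance (suc s)
    ; rank-< = λ {s} eq → subst (λ v → distance v < distance (suc s)) eq (proj₂ (proj₂ (closer s)))
    }

  open Ranked ranked

  from-edge : ∀ {u v} → u — v → Adj A u v
  from-edge (inj₁ (s , refl , refl)) = trans (symmetric _ _) (proj₁ (proj₂ (closer s)))
  from-edge (inj₂ (s , refl , refl)) = proj₁ (proj₂ (closer s))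

  routes : ∀ u → Star {R = _—_} u zero × Star {R = _—_} zero u
  routes = parent-induction (ε , ε) λ s (w , w′) →
    (inj₂ (s , refl , refl) ◂ w) , (w′ ◂◂ (inj₁ (s , refl , refl) ◂ ε))

  -- The edges to parents already connect `u` with `v` through the root, so any further edge would
  -- close a cycle.
  to-edge : ∀ {u v} → Adj A u v → u — v
  to-edge {u} {v} uv = decidable-stable (u —? v)
    (no-second-route acyclic from-edge
      (proj₁ (routes u) ◂◂ proj₂ (routes v))
      (λ { refl → contradiction (trans (sym uv) (loopless u)) λ () })
      (trans (symmetric v u) uv))

-- The cyclic order of the slots

-- Adding `i * k` completes `i` to a multiple of `suc k`, and so undoes the addition of `i`.
+-cancelʳ-% : ∀ k i {a b} → (a + i) % suc k ≡ (b + i) % suc k → a % suc k ≡ b % suc k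
+-cancelʳ-% k i {a} {b} eq = trans (sym (recover a)) (trans (cong (λ c → (c + i * k % suc k) % suc k) eq) (recover b))
  where
  open ≡-Reasoning
  recover : ∀ a → ((a + i) % suc k + i * k % suc k) % suc k ≡ a % suc k
  recover a = begin
    ((a + i) % suc k + i * k % suc k) % suc k  ≡⟨ ℕ.%-distribˡ-+ (a + i) (i * k) (suc k) ⟨
    (a + i + i * k) % suc k                    ≡⟨ cong (_% suc k) (trans (ℕ.+-assoc a i _) (cong (a +_) (sym (ℕ.*-suc i k)))) ⟩
    (a + i * suc k) % suc k                    ≡⟨ ℕ.[m+kn]%n≡m%n a i (suc k) ⟩
    a % suc k                                  ∎

module Cycle (k : ℕ) where

  prev : Fin (suc k) → Fin (suc k)
  prev zero    = fromℕ k
  prev (suc s) = inject₁ s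

  prev-injective : ∀ {s t} → prev s ≡ prev t → s ≡ t
  prev-injective {zero}  {zero}  eq = refl
  prev-injective {zero}  {suc t} eq = contradiction eq Fin.fromℕ≢inject₁
  prev-injective {suc s} {zero}  eq = contradiction (sym eq) Fin.fromℕ≢inject₁
  prev-injective {suc s} {suc t} eq = cong suc (Fin.inject₁-injective eq)

  -- A cycle with one link cut at `s` is still a path. Slots from `s` on are joined to the last
  -- slot, those below `s` to slot zero and from there to the last one.
  prev-constant : {B : Set} (φ : Fin (suc k) → B) (s : Fin (suc k)) →
                  (∀ t → t ≢ s → φ t ≡ φ (prev t)) → ∀ t u → φ t ≡ φ u
  prev-constant φ s eq t u = trans (≡φlast s eq t) (sym (≡φlast s eq u))
    where
    above : ∀ s → (∀ t → t ≢ s → φ t ≡ φ (prev t)) → ∀ t → toℕ s ≤ toℕ t → φ t ≡ φ (fromℕ k)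
    above s eq = >-weakInduction _ (λ _ → refl) λ i ih s≤i →
      let s≤i′ = subst (toℕ s ≤_) (Fin.toℕ-inject₁ i) s≤i in
      trans (sym (eq (suc i) λ { refl → ℕ.1+n≰n s≤i′ })) (ih (ℕ.m≤n⇒m≤1+n s≤i′))
    below : ∀ s → (∀ t → t ≢ s → φ t ≡ φ (prev t)) → ∀ t → toℕ t < toℕ s → φ t ≡ φ zero
    below s eq = <-weakInduction _ (λ _ → refl) λ i ih i<s →
      trans (eq (suc i) λ { refl → ℕ.<-irrefl refl i<s })
            (ih (subst (_< toℕ s) (sym (Fin.toℕ-inject₁ i)) (ℕ.<-trans (ℕ.n<1+n _) i<s)))
    ≡φlast : ∀ s → (∀ t → t ≢ s → φ t ≡ φ (prev t)) → ∀ t → φ t ≡ φ (fromℕ k)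
    ≡φlast zero    eq t = above zero eq t z≤n
    ≡φlast (suc s) eq t with toℕ t ℕ.<? suc (toℕ s)
    ... | yes t<s = trans (below (suc s) eq t t<s) (eq zero λ ())
    ... | no  t≮s = above (suc s) eq t (ℕ.≮⇒≥ t≮s)

  -- The slot met by the i-th letter from the right end of the word.
  σ : ℕ → Fin (suc k)
  σ zero    = fromℕ k
  σ (suc i) = prev (σ i)

  -- The number of letters read since slot s was last met.
  δ : Fin (suc k) → ℕ → ℕ
  δ s i = (toℕ s + i) % suc k

  δ<m : ∀ s i → δ s i < suc k
  δ<m s i = ℕ.m%n<n (toℕ s + i) (suc k)

  δ-σ : ∀ i → δ (σ i) i ≡ k
  δ-σ i = go (σ i) i refl
    where
    last%m : k % suc k ≡ k
    last%m = ℕ.m<n⇒m%n≡m ℕ.≤-refl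
    go : ∀ s i → s ≡ σ i → δ s i ≡ k
    go _ zero refl = trans (cong (_% suc k) (trans (ℕ.+-identityʳ _) (Fin.toℕ-fromℕ k))) last%m
    go _ (suc i) refl with σ i | go (σ i) i refl
    ... | suc s | ih = trans (cong (_% suc k) (trans (cong (_+ suc i) (Fin.toℕ-inject₁ s)) (ℕ.+-suc (toℕ s) i))) ih
    ... | zero  | ih = begin
      (toℕ (fromℕ k) + suc i) % suc k  ≡⟨ cong (λ j → (j + suc i) % suc k) (Fin.toℕ-fromℕ k) ⟩
      (k + suc i) % suc k              ≡⟨ cong (_% suc k) (trans (ℕ.+-suc k i) (ℕ.+-comm (suc k) i)) ⟩
      (i + suc k) % suc k              ≡⟨ ℕ.[m+n]%n≡m%n i (suc k) ⟩
      i % suc k                        ≡⟨ ih ⟩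
      k                                ∎
      where open ≡-Reasoning

  δ-injective : ∀ {s t} i → δ s i ≡ δ t i → s ≡ t
  δ-injective {s} {t} i eq = Fin.toℕ-injective (begin
    toℕ s          ≡⟨ ℕ.m<n⇒m%n≡m (Fin.toℕ<n s) ⟨
    toℕ s % suc k  ≡⟨ +-cancelʳ-% k i {toℕ s} {toℕ t} eq ⟩
    toℕ t % suc k  ≡⟨ ℕ.m<n⇒m%n≡m (Fin.toℕ<n t) ⟩
    toℕ t          ∎)
    where open ≡-Reasoning

  suc-% : ∀ a → suc a % suc k ≡ suc (a % suc k) % suc k
  suc-% a = begin
    suc a % suc k                                      ≡⟨ cong (λ b → suc b % suc k) (ℕ.m≡m%n+[m/n]*n a (suc k)) ⟩
    (suc (a % suc k) + (a ℕ./ suc k) * suc k) % suc k  ≡⟨ ℕ.[m+kn]%n≡m%n (suc (a % suc k)) (a ℕ./ suc k) (suc k) ⟩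
    suc (a % suc k) % suc k                            ∎
    where open ≡-Reasoning

  δ-suc-σ : ∀ i → δ (σ i) (suc i) ≡ 0
  δ-suc-σ i = begin
    (toℕ (σ i) + suc i) % suc k  ≡⟨ cong (_% suc k) (ℕ.+-suc (toℕ (σ i)) i) ⟩
    suc (toℕ (σ i) + i) % suc k  ≡⟨ suc-% (toℕ (σ i) + i) ⟩
    suc (δ (σ i) i) % suc k      ≡⟨ cong (λ a → suc a % suc k) (δ-σ i) ⟩
    suc k % suc k                ≡⟨ ℕ.n%n≡0 (suc k) ⟩
    0                            ∎
    where open ≡-Reasoning

  δ<k : ∀ {s} i → s ≢ σ i → δ s i < k
  δ<k {s} i s≢σ = ℕ.≤∧≢⇒< (ℕ.≤-pred (δ<m s i)) λ eq → s≢σ (δ-injective i (trans eq (sym (δ-σ i))))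

  δ-suc-≢ : ∀ {s} i → s ≢ σ i → δ s (suc i) ≡ suc (δ s i)
  δ-suc-≢ {s} i s≢σ = begin
    (toℕ s + suc i) % suc k  ≡⟨ cong (_% suc k) (ℕ.+-suc (toℕ s) i) ⟩
    suc (toℕ s + i) % suc k  ≡⟨ suc-% (toℕ s + i) ⟩
    suc (δ s i) % suc k      ≡⟨ ℕ.m<n⇒m%n≡m (s≤s (δ<k i s≢σ)) ⟩
    suc (δ s i)              ∎
    where open ≡-Reasoning

  δ-period : ∀ r s → δ s (r * suc k) ≡ toℕ s
  δ-period r s = trans (ℕ.[m+kn]%n≡m%n (toℕ s) r (suc k)) (ℕ.m<n⇒m%n≡m (Fin.toℕ<n s))

  σ-period : ∀ {N} r → N ≡ r * suc k → σ N ≡ σ 0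
  σ-period r refl = δ-injective (r * suc k) (trans (δ-σ (r * suc k)) (sym (trans (δ-period r (σ 0)) (Fin.toℕ-fromℕ k))))

  -- Moving time on by one turns visits to `s` into visits to `prev s`. All slots thus have equally
  -- many visits, and together they have `N`.
  visits : ∀ {N} r → N ≡ r * suc k → ∀ s → count (λ i → σ i Fin.≟ s) N ≡ r
  visits {N} r N≡ s = ℕ.*-cancelˡ-≡ _ _ (suc k) (begin
    suc k * visit s                         ≡⟨ sum-const (suc k) (visit s) ⟨
    sum {suc k} (λ _ → visit s)             ≡⟨ sum-cong-≗ (λ t → prev-constant visit s (λ t _ → prev-visit t) s t) ⟩
    sum visit                               ≡⟨ ∑<-sum N (λ i s → ⟦ σ i Fin.≟ s ⟧) ⟨
    ∑< N (λ i → sum λ s → ⟦ σ i Fin.≟ s ⟧)  ≡⟨ ∑<-cong N (λ i _ → sum-⟦≟⟧ (σ i)) ⟩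
    ∑< N (λ _ → 1)                          ≡⟨ ∑<-one N ⟩
    N                                       ≡⟨ trans N≡ (ℕ.*-comm r (suc k)) ⟩
    suc k * r                               ∎)
    where
    open ≡-Reasoning
    visit : Fin (suc k) → ℕ
    visit s = count (λ i → σ i Fin.≟ s) N
    prev-visit : ∀ s → visit s ≡ visit (prev s)
    prev-visit s = begin
      visit s
        ≡⟨ ∑<-cong N (λ i _ → ⟦⟧-cong (σ i Fin.≟ s) (σ (suc i) Fin.≟ prev s) (cong prev) prev-injective) ⟩
      ∑< N (λ i → ⟦ σ (suc i) Fin.≟ prev s ⟧)
        ≡⟨ ∑<-shift N (λ i → ⟦ σ i Fin.≟ prev s ⟧) (cong (λ t → ⟦ t Fin.≟ prev s ⟧) (σ-period r N≡)) ⟩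
      visit (prev s)  ∎

-- Transpositions and the moving hand

module _ {n} (i j : Fin n) where

  transpose-i : transpose i j i ≡ j
  transpose-i rewrite dec-true (i Fin.≟ i) refl = refl

  transpose-j : transpose i j j ≡ i
  transpose-j with j Fin.≟ i
  ... | yes j≡i = j≡i
  ... | no  _ rewrite dec-true (j Fin.≟ j) refl = refl

  transpose-other : ∀ {x} → x ≢ i → x ≢ j → transpose i j x ≡ x
  transpose-other {x} x≢i x≢j rewrite dec-false (x Fin.≟ i) x≢i | dec-false (x Fin.≟ j) x≢j = refl

  transpose-involutive : ∀ x → transpose i j (transpose i j x) ≡ x
  transpose-involutive x = go (x Fin.≟ i) (x Fin.≟ j)
    where
    go : Dec (x ≡ i) → Dec (x ≡ j) → transpose i j (transpose i j x) ≡ x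
    go (yes refl) _          = trans (cong (transpose i j) transpose-i) transpose-j
    go (no _)     (yes refl) = trans (cong (transpose i j) transpose-j) transpose-i
    go (no x≢i)   (no x≢j)   = trans (cong (transpose i j) (transpose-other x≢i x≢j)) (transpose-other x≢i x≢j)

  transpose-injective : ∀ {x y} → transpose i j x ≡ transpose i j y → x ≡ y
  transpose-injective {x} {y} eq =
    trans (sym (transpose-involutive x)) (trans (cong (transpose i j) eq) (transpose-involutive y))

move : ∀ {m} → Bool → Fin m → Fin (suc m) → Fin (suc m)
move true  s ℓ = ℓ
move false s ℓ = transpose zero (suc s) ℓ

move-involutive : ∀ {m} b (s : Fin m) ℓ → move b s (move b s ℓ) ≡ ℓ
move-involutive true  s ℓ = refl
move-involutive false s ℓ = transpose-involutive zero (suc s) ℓ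

-- γ i tells whether the i-th letter from the right end of the word is taken.  Location zero is
-- the hand and location suc s is slot s; conf i ℓ is the object at location ℓ after i letters.
module Run (k : ℕ) (γ : ℕ → Bool) where

  open Cycle k

  conf : ℕ → Fin (suc (suc k)) → Fin (suc (suc k))
  conf zero    ℓ = ℓ
  conf (suc i) ℓ = conf i (move (γ i) (σ i) ℓ)

  hand : ℕ → Fin (suc (suc k))
  hand i = conf i zero

  slot : ℕ → Fin (suc k) → Fin (suc (suc k))
  slot i s = conf i (suc s)

  met : ℕ → Fin (suc (suc k)) → ℕ
  met N o = count (λ i → slot i (σ i) Fin.≟ o) N

  taken : ∀ {i} → γ i ≡ true → ∀ ℓ → conf (suc i) ℓ ≡ conf i ℓ
  taken γi ℓ rewrite γi = refl

  skipped-hand : ∀ {i} → γ i ≡ false → hand (suc i) ≡ slot i (σ i)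
  skipped-hand γi rewrite γi = refl

  skipped-slot : ∀ {i} → γ i ≡ false → slot (suc i) (σ i) ≡ hand i
  skipped-slot {i} γi rewrite γi = cong (conf i) (transpose-j zero (suc (σ i)))

  slot-other : ∀ {i s} → s ≢ σ i → slot (suc i) s ≡ slot i s
  slot-other {i} {s} s≢σ with γ i
  ... | true  = refl
  ... | false = cong (conf i) (transpose-other zero (suc (σ i)) (λ ()) (s≢σ ∘ Fin.suc-injective))

  conf-injective : ∀ i {ℓ ℓ′} → conf i ℓ ≡ conf i ℓ′ → ℓ ≡ ℓ′
  conf-injective zero    eq = eq
  conf-injective (suc i) {ℓ} {ℓ′} eq =
    trans (sym (move-involutive (γ i) (σ i) ℓ))
      (trans (cong (move (γ i) (σ i)) (conf-injective i eq)) (move-involutive (γ i) (σ i) ℓ′))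

  conf-surjective : ∀ i o → ∃ λ ℓ → conf i ℓ ≡ o
  conf-surjective zero    o = o , refl
  conf-surjective (suc i) o =
    let (ℓ , eq) = conf-surjective i o
    in move (γ i) (σ i) ℓ , trans (cong (conf i) (move-involutive (γ i) (σ i) ℓ)) eq

  -- Local conservation law for `h` at slot `s`: an exchange swaps the two summands, and any other
  -- letter leaves both alone. The occupancy of the slot is the potential for telescoping.
  conserved : ∀ i h s →
    ⟦ hand (suc i) Fin.≟ h ×-dec σ i Fin.≟ s ⟧ + ⟦ slot (suc i) s Fin.≟ h ⟧ ≡
    ⟦ hand i Fin.≟ h ×-dec σ i Fin.≟ s ⟧ + ⟦ slot i s Fin.≟ h ⟧
  conserved i h s with σ i Fin.≟ s
  ... | no  σ≢s = cong₂ _+_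
    (trans (⟦⟧-no (hand (suc i) Fin.≟ h ×-dec no σ≢s) (σ≢s ∘ proj₂)) (sym (⟦⟧-no (hand i Fin.≟ h ×-dec no σ≢s) (σ≢s ∘ proj₂))))
    (cong (λ o → ⟦ o Fin.≟ h ⟧) (slot-other {i} (≢-sym σ≢s)))
  ... | yes refl with γ i in γi
  ...   | true  = refl
  ...   | false = begin
    ⟦ slot i (σ i) Fin.≟ h ×-dec yes refl ⟧ + ⟦ conf i (transpose zero (suc (σ i)) (suc (σ i))) Fin.≟ h ⟧
      ≡⟨ cong₂ _+_ (×yes _) (cong (λ ℓ → ⟦ conf i ℓ Fin.≟ h ⟧) (transpose-j zero (suc (σ i)))) ⟩
    ⟦ slot i (σ i) Fin.≟ h ⟧ + ⟦ hand i Fin.≟ h ⟧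
      ≡⟨ ℕ.+-comm ⟦ slot i (σ i) Fin.≟ h ⟧ _ ⟩
    ⟦ hand i Fin.≟ h ⟧ + ⟦ slot i (σ i) Fin.≟ h ⟧
      ≡⟨ cong (_+ ⟦ slot i (σ i) Fin.≟ h ⟧) (×yes (hand i Fin.≟ h)) ⟨
    ⟦ hand i Fin.≟ h ×-dec yes refl ⟧ + ⟦ slot i (σ i) Fin.≟ h ⟧  ∎
    where
    open ≡-Reasoning
    ×yes : {A B : Set} {b : B} (a? : Dec A) → ⟦ a? ×-dec yes b ⟧ ≡ ⟦ a? ⟧
    ×yes {b = b} a? = ⟦⟧-cong (a? ×-dec yes b) a? proj₁ (_, b)

  met+ : ∀ i {o} → slot i (σ i) ≡ o → met (suc i) o ≡ suc (met i o)
  met+ i {o} eq = cong (_+ met i o) (⟦⟧-yes (slot i (σ i) Fin.≟ o) eq)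

  met= : ∀ i {o} → slot i (σ i) ≢ o → met (suc i) o ≡ met i o
  met= i {o} neq = cong (_+ met i o) (⟦⟧-no (slot i (σ i) Fin.≟ o) neq)

  -- Here the object is the one in the hand, whereas `met` looks at the object in the slot.
  meetings : ℕ → Fin (suc (suc k)) → Fin (suc k) → ℕ
  meetings N h s = count (λ i → hand i Fin.≟ h ×-dec σ i Fin.≟ s) N

  meetings-sum : ∀ {N} r → N ≡ r * suc k → ∀ s → sum (λ h → meetings N h s) ≡ r
  meetings-sum {N} r N≡ s = begin
    sum (λ h → meetings N h s)
      ≡⟨ ∑<-sum N (λ i h → ⟦ hand i Fin.≟ h ×-dec σ i Fin.≟ s ⟧) ⟨
    ∑< N (λ i → sum λ h → ⟦ hand i Fin.≟ h ×-dec σ i Fin.≟ s ⟧)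
      ≡⟨ ∑<-cong N (λ i _ → trans (sum-cong-≗ λ h → ⟦⟧-cong (hand i Fin.≟ h ×-dec σ i Fin.≟ s) (σ i Fin.≟ s ×-dec hand i Fin.≟ h) swap swap)
                                  (sum-×≟ (σ i Fin.≟ s) (hand i))) ⟩
    count (λ i → σ i Fin.≟ s) N
      ≡⟨ visits r N≡ s ⟩
    r ∎
    where
    open ≡-Reasoning

  -- Each slot hands over an object h as often as it receives it, so the number of visits
  -- of h to the slots is the same all around the cycle.
  meetings-constant : ∀ {N} r → N ≡ r * suc k → (∀ ℓ → conf N ℓ ≡ ℓ) → ∀ h s t →
                      meetings N h s ≡ meetings N h t
  meetings-constant {N} r N≡ closed h s t = prev-constant (meetings N h) s (λ u _ → turn u) s t
    where
    open ≡-Reasoning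
    turn : ∀ u → meetings N h u ≡ meetings N h (prev u)
    turn u = ℕ.+-cancelʳ-≡ ⟦ suc u Fin.≟ h ⟧ _ _ (begin
      meetings N h u + ⟦ suc u Fin.≟ h ⟧
        ≡⟨ ∑<-telescope N (λ i → ⟦ slot i u Fin.≟ h ⟧) (λ i _ → conserved i h u) ⟨
      ∑< N (λ i → ⟦ hand (suc i) Fin.≟ h ×-dec σ i Fin.≟ u ⟧) + ⟦ slot N u Fin.≟ h ⟧
        -- What the hand carries away from `u` is what it brings to the next slot `prev u`. The
        -- shift of time is cyclic because the run closes up.
        ≡⟨ cong₂ _+_
             (trans (∑<-cong N λ i _ → ⟦⟧-cong (hand (suc i) Fin.≟ h ×-dec σ i Fin.≟ u) (hand (suc i) Fin.≟ h ×-dec σ (suc i) Fin.≟ prev u)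
                                         (map₂ (cong prev)) (map₂ prev-injective))
                    (∑<-shift N (λ i → ⟦ hand i Fin.≟ h ×-dec σ i Fin.≟ prev u ⟧)
                      (cong₂ (λ h′ s′ → ⟦ h′ Fin.≟ h ×-dec s′ Fin.≟ prev u ⟧) (closed zero) (σ-period r N≡))))
             (cong (λ o → ⟦ o Fin.≟ h ⟧) (closed (suc u))) ⟩
      meetings N h (prev u) + ⟦ suc u Fin.≟ h ⟧  ∎)

-- Action on ℤ

fromBits : (i : ℕ) → (ℕ → Bool) → Vec Bool i
fromBits zero    γ = []
fromBits (suc i) γ = γ i ∷ fromBits i γ

module Affine (k : ℕ) where

  open Cycle k

  private
    m n : ℕ
    m = suc k
    n = suc (suc k)

  -- For `a < n` this is the integer with residue `a` and winding number `w`.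
  at : ℕ → ℤ → ℤ
  at a w = ℤ.+ a ℤ.+ w ℤ.* ℤ.+ n

  at-+ : ∀ a b c w → a ≡ b + c * n → at a w ≡ at b (w ℤ.+ ℤ.+ c)
  at-+ a b c w refl = begin
    ℤ.+ (b + c * n) ℤ.+ w ℤ.* ℤ.+ n                ≡⟨ cong (ℤ._+ w ℤ.* ℤ.+ n) (trans (ℤ.pos-+ b (c * n)) (cong (ℤ._+_ (ℤ.+ b)) (ℤ.pos-* c n))) ⟩
    ℤ.+ b ℤ.+ ℤ.+ c ℤ.* ℤ.+ n ℤ.+ w ℤ.* ℤ.+ n    ≡⟨ regroup (ℤ.+ b) (ℤ.+ c) w (ℤ.+ n) ⟩
    ℤ.+ b ℤ.+ (w ℤ.+ ℤ.+ c) ℤ.* ℤ.+ n            ∎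
    where
    open ≡-Reasoning
    regroup : ∀ b c w n → b ℤ.+ c ℤ.* n ℤ.+ w ℤ.* n ≡ b ℤ.+ (w ℤ.+ c) ℤ.* n
    regroup = solve-∀

  suc-at : ∀ a w → at a w ℤ.+ ℤ.1ℤ ≡ at (suc a) w
  suc-at a w = trans (regroup (ℤ.+ a) (w ℤ.* ℤ.+ n)) (cong (ℤ._+ w ℤ.* ℤ.+ n) (sym (ℤ.pos-+ 1 a)))
    where
    regroup : ∀ a b → a ℤ.+ b ℤ.+ ℤ.1ℤ ≡ ℤ.1ℤ ℤ.+ a ℤ.+ b
    regroup = solve-∀

  pred-at : ∀ a w → at (suc a) w ℤ.- ℤ.1ℤ ≡ at a w
  pred-at a w = trans (cong (ℤ._- ℤ.1ℤ) (sym (suc-at a w))) (regroup (at a w))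
    where
    regroup : ∀ a → a ℤ.+ ℤ.1ℤ ℤ.- ℤ.1ℤ ≡ a
    regroup = solve-∀

  at-%-0 : ∀ a b w → at a w ≡ ℤ.+ b → a % n ≡ b % n
  at-%-0 a b (ℤ.+ c) eq = trans (sym (ℕ.[m+kn]%n≡m%n a c n)) (cong (_% n) (ℤ.+-injective (begin
    ℤ.+ (a + c * n)             ≡⟨ trans (ℤ.pos-+ a (c * n)) (cong (ℤ._+_ (ℤ.+ a)) (ℤ.pos-* c n)) ⟩
    at a (ℤ.+ c)                ≡⟨ eq ⟩
    ℤ.+ b                       ∎)))
    where open ≡-Reasoning
  at-%-0 a b ℤ.-[1+ c ] eq = trans (cong (_% n) (ℤ.+-injective (begin
    ℤ.+ a                                            ≡⟨ regroup (ℤ.+ a) ℤ.-[1+ c ] (ℤ.+ n) ⟩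
    at a ℤ.-[1+ c ] ℤ.+ ℤ.+ suc c ℤ.* ℤ.+ n          ≡⟨ cong (ℤ._+ ℤ.+ suc c ℤ.* ℤ.+ n) eq ⟩
    ℤ.+ b ℤ.+ ℤ.+ suc c ℤ.* ℤ.+ n                    ≡⟨ trans (ℤ.pos-+ b (suc c * n)) (cong (ℤ._+_ (ℤ.+ b)) (ℤ.pos-* (suc c) n)) ⟨
    ℤ.+ (b + suc c * n)                              ∎))) (ℕ.[m+kn]%n≡m%n b (suc c) n)
    where
    open ≡-Reasoning
    regroup : ∀ a w n → a ≡ a ℤ.+ w ℤ.* n ℤ.+ (ℤ.- w) ℤ.* n
    regroup = solve-∀

  at-% : ∀ {a b w v} → at a w ≡ at b v → a % n ≡ b % n
  at-% {a} {b} {w} {v} eq = at-%-0 a b (w ℤ.- v) (begin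
    ℤ.+ a ℤ.+ (w ℤ.- v) ℤ.* ℤ.+ n                 ≡⟨ regroup (ℤ.+ a) w v (ℤ.+ n) ⟩
    at a w ℤ.- v ℤ.* ℤ.+ n                        ≡⟨ cong (ℤ._- v ℤ.* ℤ.+ n) eq ⟩
    at b v ℤ.- v ℤ.* ℤ.+ n                        ≡⟨ cancel (ℤ.+ b) (v ℤ.* ℤ.+ n) ⟩
    ℤ.+ b                                         ∎)
    where
    open ≡-Reasoning
    regroup : ∀ a w v n → a ℤ.+ (w ℤ.- v) ℤ.* n ≡ a ℤ.+ w ℤ.* n ℤ.- v ℤ.* n
    regroup = solve-∀
    cancel : ∀ b c → b ℤ.+ c ℤ.- c ≡ b
    cancel = solve-∀

  at-injective : ∀ {a b w v} → a < n → b < n → at a w ≡ at b v → a ≡ b × w ≡ v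
  at-injective {a} {b} {w} {v} a<n b<n eq = a≡b ,
    ℤ.*-cancelʳ-≡ w v (ℤ.+ n) (ℤ+.∙-cancelˡ (ℤ.+ a) _ _ (trans eq (cong (λ c → at c v) (sym a≡b))))
    where
    a≡b : a ≡ b
    a≡b = trans (sym (ℕ.m<n⇒m%n≡m a<n)) (trans (at-% {a} {b} {w} {v} eq) (ℕ.m<n⇒m%n≡m b<n))

  at-%ℕ : ∀ a w → at a w %ℕ n ≡ a % n
  at-%ℕ a w = trans (sym (ℕ.m<n⇒m%n≡m (ℤ.n%ℕd<d (at a w) n)))
    (at-% {w = at a w ℤ./ℕ n} {v = w} (sym (ℤ.a≡a%ℕn+[a/ℕn]*n (at a w) n)))

  +-≢-% : ∀ p {d} → suc d < n → (suc d + p) % n ≢ p % n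
  +-≢-% p {d} d<n eq with trans (sym (ℕ.m<n⇒m%n≡m d<n)) (+-cancelʳ-% m p {suc d} {0} eq)
  ... | ()

  ≡ᵇ-true : ∀ {a b} → a ≡ b → (a ≡ᵇ b) ≡ true
  ≡ᵇ-true {a} {b} eq = dec-true (a ≟ b) eq

  ≡ᵇ-false : ∀ {a b} → a ≢ b → (a ≡ᵇ b) ≡ false
  ≡ᵇ-false {a} {b} neq = dec-false (a ≟ b) neq

  s-up : ∀ p a w → a % n ≡ p % n → s n p (at a w) ≡ at (suc a) w
  s-up p a w eq rewrite at-%ℕ a w | ≡ᵇ-true eq = suc-at a w

  s-down : ∀ p w → s n p (at (suc p) w) ≡ at p w
  s-down p w rewrite at-%ℕ (suc p) w | ≡ᵇ-false (+-≢-% p {0} (s≤s (s≤s z≤n))) | ≡ᵇ-true {suc p % n} refl = pred-at p w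

  s-fix : ∀ p {d} w → d < k → s n p (at (suc (suc d) + p) w) ≡ at (suc (suc d) + p) w
  s-fix p {d} w d<k
    rewrite at-%ℕ (suc (suc d) + p) w
          | ≡ᵇ-false (+-≢-% p {suc d} (s≤s (s≤s d<k)))
          | ≡ᵇ-false (subst (λ a → a % n ≢ suc p % n) (ℕ.+-suc (suc d) p) (+-≢-% (suc p) {d} (s≤s (ℕ.m<n⇒m<1+n d<k)))) = refl

  -- The hand stands at the current letter, and the slots follow it in the order in which they were
  -- last met, the most recent one first.
  offset : ℕ → Fin n → ℕ
  offset i zero    = 0
  offset i (suc s) = suc (δ s i)

  offset-period : ∀ r ℓ → offset (r * suc k) ℓ ≡ toℕ ℓ
  offset-period r zero    = refl
  offset-period r (suc s) = cong suc (δ-period r s)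

  module _ (γ : ℕ → Bool) where

    open Run k γ

    -- Normalised so that an object met exactly `m` times ends with its original winding number `z`.
    weight : ℕ → Fin n → ℤ → ℤ
    weight i o z = z ℤ.+ ℤ.+ met i o ℤ.- ℤ.+ m

    weight+ : ∀ i {o} z → slot i (σ i) ≡ o → weight (suc i) o z ≡ weight i o z ℤ.+ ℤ.1ℤ
    weight+ i {o} z eq = begin
      z ℤ.+ ℤ.+ met (suc i) o ℤ.- ℤ.+ m            ≡⟨ cong (λ c → z ℤ.+ ℤ.+ c ℤ.- ℤ.+ m) (met+ i eq) ⟩
      z ℤ.+ ℤ.+ suc (met i o) ℤ.- ℤ.+ m            ≡⟨ cong (λ c → z ℤ.+ c ℤ.- ℤ.+ m) (ℤ.pos-+ 1 (met i o)) ⟩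
      z ℤ.+ (ℤ.1ℤ ℤ.+ ℤ.+ met i o) ℤ.- ℤ.+ m       ≡⟨ regroup z (ℤ.+ met i o) (ℤ.+ m) ⟩
      weight i o z ℤ.+ ℤ.1ℤ                        ∎
      where
      open ≡-Reasoning
      regroup : ∀ z c m → z ℤ.+ (ℤ.1ℤ ℤ.+ c) ℤ.- m ≡ z ℤ.+ c ℤ.- m ℤ.+ ℤ.1ℤ
      regroup = solve-∀

    weight= : ∀ i {o} z → slot i (σ i) ≢ o → weight (suc i) o z ≡ weight i o z
    weight= i z neq = cong (λ c → z ℤ.+ ℤ.+ c ℤ.- ℤ.+ m) (met= i neq)

    -- An object sits where its slot was last met, so its winding number counts how often
    -- it has been met in a slot.
    position : ∀ i p → p + i ≡ n * m → ∀ ℓ z →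
      prodFrom n p (fromBits i γ) (at (toℕ (conf i ℓ)) z) ≡ at (offset i ℓ + p) (weight i (conf i ℓ) z)
    position zero p eq ℓ z = begin
      at (toℕ ℓ) z                              ≡⟨ cong (at (toℕ ℓ)) (regroup z (ℤ.+ m)) ⟩
      at (toℕ ℓ) (weight 0 ℓ z ℤ.+ ℤ.+ m)       ≡⟨ at-+ (offset 0 ℓ + p) (toℕ ℓ) m (weight 0 ℓ z) offset₀ ⟨
      at (offset 0 ℓ + p) (weight 0 ℓ z)        ∎
      where
      open ≡-Reasoning
      regroup : ∀ z m → z ≡ z ℤ.+ ℤ.0ℤ ℤ.- m ℤ.+ m
      regroup = solve-∀
      -- At the right end of the word `p` equals `n * m`, which is `m` full turns; this accounts for
      -- the `m` subtracted in `weight`.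
      offset₀ : offset 0 ℓ + p ≡ toℕ ℓ + m * n
      offset₀ = cong₂ _+_ (offset-period 0 ℓ) (trans (sym (ℕ.+-identityʳ p)) (trans eq (ℕ.*-comm n m)))
    position (suc i) p eq ℓ z
      rewrite position i (suc p) (trans (sym (ℕ.+-suc p i)) eq) (move (γ i) (σ i) ℓ) z = letter-at (γ i) refl ℓ
      where
      open ≡-Reasoning
      cycle : ∀ o → slot i (σ i) ≡ o → at (n + p) (weight i o z) ≡ at p (weight (suc i) o z)
      cycle o eq = begin
        at (n + p) (weight i o z)          ≡⟨ at-+ (n + p) p 1 (weight i o z) (trans (ℕ.+-comm n p) (cong (p +_) (sym (ℕ.+-identityʳ n)))) ⟩
        at p (weight i o z ℤ.+ ℤ.1ℤ)       ≡⟨ cong (at p) (weight+ i z eq) ⟨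
        at p (weight (suc i) o z)          ∎
      slot≢hand : slot i (σ i) ≢ hand i
      slot≢hand eq with conf-injective i eq
      ... | ()
      last : suc (δ (σ i) i) + suc p ≡ n + p
      last = trans (ℕ.+-suc _ p) (cong (λ d → suc (suc (d + p))) (δ-σ i))
      pos-other : ∀ {s} → s ≢ σ i → at (suc (δ s i) + suc p) (weight i (slot i s) z) ≡ at (suc (δ s (suc i)) + p) (weight (suc i) (slot i s) z)
      pos-other {s} s≢σ = cong₂ at
        (trans (ℕ.+-suc _ p) (cong (λ d → suc (d + p)) (sym (δ-suc-≢ i s≢σ))))
        (sym (weight= i z λ eq → s≢σ (sym (Fin.suc-injective (conf-injective i eq)))))
      -- Before the letter the hand stands at `p + 1` and the met object at `n + p`. A taken letter
      -- moves them to `p` and `n + p + 1`. A skipped letter moves neither, but modulo `n` the met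
      -- object now stands in the place of the hand, and the former hand in that of the slot. Either
      -- way the met object gains one winding.
      letter-at : ∀ b → γ i ≡ b → ∀ ℓ →
        letter n p b (at (offset i (move b (σ i) ℓ) + suc p) (weight i (conf i (move b (σ i) ℓ)) z)) ≡
        at (offset (suc i) ℓ + p) (weight (suc i) (conf i (move b (σ i) ℓ)) z)
      letter-at true γi zero = trans (s-down p (weight i (hand i) z)) (cong (at p) (sym (weight= i z slot≢hand)))
      letter-at true γi (suc s) with s Fin.≟ σ i
      ... | yes refl = begin
        reflect p (at (suc (δ (σ i) i) + suc p) w)   ≡⟨ cong (λ a → reflect p (at a w)) last ⟩
        reflect p (at (n + p) w)                     ≡⟨ s-up p (n + p) w (trans (cong (_% n) (ℕ.+-comm n p)) (ℕ.[m+n]%n≡m%n p n)) ⟩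
        at (suc (n + p)) w                      ≡⟨ suc-at (n + p) w ⟨
        at (n + p) w ℤ.+ ℤ.1ℤ                   ≡⟨ cong (ℤ._+ ℤ.1ℤ) (cycle _ refl) ⟩
        at p v ℤ.+ ℤ.1ℤ                         ≡⟨ suc-at p v ⟩
        at (1 + p) v                            ≡⟨ cong (λ d → at (suc d + p) v) (δ-suc-σ i) ⟨
        at (suc (δ (σ i) (suc i)) + p) v        ∎
        where
        reflect = Defs.s n
        w = weight i (slot i (σ i)) z
        v = weight (suc i) (slot i (σ i)) z
      ... | no s≢σ = trans
        (trans (cong (λ a → Defs.s n p (at a w)) (ℕ.+-suc _ p)) (trans (s-fix p w (δ<k i s≢σ)) (cong (λ a → at a w) (sym (ℕ.+-suc _ p)))))
        (pos-other s≢σ)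
        where w = weight i (slot i s) z
      letter-at false γi zero = trans (cong (λ a → at a (weight i (slot i (σ i)) z)) last) (cycle _ refl)
      letter-at false γi (suc s) with s Fin.≟ σ i
      ... | yes refl = cong₂ at
        (cong (λ d → suc (d + p)) (sym (δ-suc-σ i)))
        (sym (weight= i z slot≢hand))
      ... | no s≢σ = pos-other s≢σ

    module _ (identity : ∀ x → prodFrom n 0 (fromBits (n * m) γ) x ≡ x) where

      private
        -- Uniqueness of residue and winding number splits the identity on integers into a condition
        -- on the final arrangement and one on the numbers of meetings.
        located : ∀ ℓ → toℕ (conf (n * m) ℓ) ≡ toℕ ℓ × ℤ.0ℤ ≡ weight (n * m) (conf (n * m) ℓ) ℤ.0ℤ
        located ℓ = at-injective (Fin.toℕ<n _) (Fin.toℕ<n ℓ) (begin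
          at (toℕ (conf (n * m) ℓ)) ℤ.0ℤ
            ≡⟨ identity _ ⟨
          prodFrom n 0 (fromBits (n * m) γ) (at (toℕ (conf (n * m) ℓ)) ℤ.0ℤ)
            ≡⟨ position (n * m) 0 refl ℓ ℤ.0ℤ ⟩
          at (offset (n * m) ℓ + 0) (weight (n * m) (conf (n * m) ℓ) ℤ.0ℤ)
            ≡⟨ cong (λ a → at a (weight (n * m) (conf (n * m) ℓ) ℤ.0ℤ)) (trans (ℕ.+-identityʳ _) (offset-period n ℓ)) ⟩
          at (toℕ ℓ) (weight (n * m) (conf (n * m) ℓ) ℤ.0ℤ)  ∎)
          where open ≡-Reasoning

      identity⇒closed : ∀ ℓ → conf (n * m) ℓ ≡ ℓ
      identity⇒closed ℓ = Fin.toℕ-injective (proj₁ (located ℓ))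

      identity⇒met : ∀ o → met (n * m) o ≡ m
      identity⇒met o = ℤ.+-injective (begin
        ℤ.+ met (n * m) o                          ≡⟨ regroup (ℤ.+ met (n * m) o) (ℤ.+ m) ⟩
        weight (n * m) o ℤ.0ℤ ℤ.+ ℤ.+ m            ≡⟨ cong (λ o → weight (n * m) o ℤ.0ℤ ℤ.+ ℤ.+ m) (identity⇒closed o) ⟨
        weight (n * m) _ ℤ.0ℤ ℤ.+ ℤ.+ m            ≡⟨ cong (ℤ._+ ℤ.+ m) (proj₂ (located o)) ⟨
        ℤ.+ m                                      ∎)
        where
        open ≡-Reasoning
        regroup : ∀ c m → c ≡ ℤ.0ℤ ℤ.+ c ℤ.- m ℤ.+ m
        regroup = solve-∀

    met⇒identity : (∀ ℓ → conf (n * m) ℓ ≡ ℓ) → (∀ o → met (n * m) o ≡ m) →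
                   ∀ x → prodFrom n 0 (fromBits (n * m) γ) x ≡ x
    met⇒identity closed met≡ x = subst (λ x → prodFrom n 0 (fromBits (n * m) γ) x ≡ x) (sym x≡) (begin
      prodFrom n 0 (fromBits (n * m) γ) (at (toℕ o) z)
        ≡⟨ cong (λ o → prodFrom n 0 (fromBits (n * m) γ) (at (toℕ o) z)) (closed o) ⟨
      prodFrom n 0 (fromBits (n * m) γ) (at (toℕ (conf (n * m) o)) z)
        ≡⟨ position (n * m) 0 refl o z ⟩
      at (offset (n * m) o + 0) (weight (n * m) (conf (n * m) o) z)
        ≡⟨ cong₂ at (trans (ℕ.+-identityʳ _) (offset-period n o)) weight≡z ⟩
      at (toℕ o) z  ∎)
      where
      open ≡-Reasoning
      o : Fin n
      o = fromℕ< (ℤ.n%ℕd<d x n)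
      z : ℤ
      z = x ℤ./ℕ n
      x≡ : x ≡ at (toℕ o) z
      x≡ = trans (ℤ.a≡a%ℕn+[a/ℕn]*n x n) (cong (λ a → at a z) (sym (Fin.toℕ-fromℕ< _)))
      cancel : ∀ z m → z ℤ.+ m ℤ.- m ≡ z
      cancel = solve-∀
      weight≡z : weight (n * m) (conf (n * m) o) z ≡ z
      weight≡z = trans (cong (λ c → z ℤ.+ ℤ.+ c ℤ.- ℤ.+ m) (met≡ _)) (cancel z (ℤ.+ m))

-- From words to trees

module Configurations {m} {q : Fin m → Fin (suc m)} (ranked : Edges.Ranked q) where

  open Edges q
  open Ranked ranked

  record IsConfiguration (c : Fin (suc m) → Fin (suc m)) : Set where
    field
      injective : ∀ {ℓ ℓ′} → c ℓ ≡ c ℓ′ → ℓ ≡ ℓ′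
      placed    : ∀ s → c (suc s) ≡ suc s ⊎ c (suc s) ≡ q s

    slots-injective : ∀ {s t} → c (suc s) ≡ c (suc t) → s ≡ t
    slots-injective = Fin.suc-injective ∘ injective

    hand≢slot : ∀ {s} → c zero ≢ c (suc s)
    hand≢slot eq with injective eq
    ... | ()

    held⇒parent-in-slot : ∀ {t} → c zero ≡ suc t → c (suc t) ≡ q t
    held⇒parent-in-slot {t} held with placed t
    ... | inj₁ home = contradiction (trans held (sym home)) hand≢slot
    ... | inj₂ away = away

    parent-held⇒in-slot : ∀ {t} → c zero ≡ q t → c (suc t) ≡ suc t
    parent-held⇒in-slot {t} held with placed t
    ... | inj₁ home = home
    ... | inj₂ away = contradiction (trans held (sym away)) hand≢slot

    -- Adjacent objects meet only in the slot of the child: if the child is held its slot contains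
    -- the parent, and if the parent is held the child is at home. Injectivity then identifies the
    -- slot.
    meet : ∀ s → c zero — c (suc s) →
           (c zero ≡ suc s × c (suc s) ≡ q s) ⊎ (c zero ≡ q s × c (suc s) ≡ suc s)
    meet s (inj₁ (t , held , in-s))
      with refl ← slots-injective {s} {t} (trans in-s (sym (parent-held⇒in-slot held))) = inj₂ (held , in-s)
    meet s (inj₂ (t , in-s , held))
      with refl ← slots-injective {s} {t} (trans in-s (sym (held⇒parent-in-slot held))) = inj₁ (held , in-s)

  module _ {c c′} (C : IsConfiguration c) (C′ : IsConfiguration c′)
    (surjective′ : ∀ o → ∃ λ ℓ → c′ ℓ ≡ o) (same-hand : c zero ≡ c′ zero) where

    private
      module C = IsConfiguration C
      module C′ = IsConfiguration C′

    -- If suc s has left its slot in c′ then it occupies the slot of one of its children,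
    -- which therefore has left its own slot too.
    no-difference : ∀ s → c (suc s) ≡ suc s → c′ (suc s) ≡ q s → ⊥
    no-difference = children-induction {λ s → c (suc s) ≡ suc s → c′ (suc s) ≡ q s → ⊥} λ s further home away′ → case s further home away′ (surjective′ (suc s))
      where
      case : ∀ s → (∀ t → q t ≡ suc s → c (suc t) ≡ suc t → c′ (suc t) ≡ q t → ⊥) →
             c (suc s) ≡ suc s → c′ (suc s) ≡ q s → (∃ λ ℓ → c′ ℓ ≡ suc s) → ⊥
      case s further home away′ (zero , held) = C.hand≢slot (trans same-hand (trans held (sym home)))
      case s further home away′ (suc t , in-t) with C′.placed t
      ... | inj₁ home-t with refl ← Fin.suc-injective (trans (sym home-t) in-t) =
        ↓-irrefl (s , trans (sym in-t) away′ , refl)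
      ... | inj₂ away-t with C.placed t
      ...   | inj₁ home-t = further t (trans (sym away-t) in-t) home-t away-t
      ...   | inj₂ away with refl ← C.slots-injective {s} {t} (trans home (trans (sym in-t) (trans away-t (sym away)))) =
        ↓-irrefl (s , trans (sym in-t) away′ , refl)

  -- By `no-difference` in both orders, no slot is at home in one arrangement and away in the other.
  -- The held object therefore records the whole arrangement.
  configuration-unique : ∀ {c c′} → IsConfiguration c → IsConfiguration c′ →
    (∀ o → ∃ λ ℓ → c ℓ ≡ o) → (∀ o → ∃ λ ℓ → c′ ℓ ≡ o) → c zero ≡ c′ zero → ∀ ℓ → c ℓ ≡ c′ ℓ
  configuration-unique C C′ sur sur′ same zero = same
  configuration-unique C C′ sur sur′ same (suc s)
    with IsConfiguration.placed C s | IsConfiguration.placed C′ s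
  ... | inj₁ home | inj₁ home′ = trans home (sym home′)
  ... | inj₂ away | inj₂ away′ = trans away (sym away′)
  ... | inj₁ home | inj₂ away′ = ⊥-elim (no-difference C C′ sur′ same s home away′)
  ... | inj₂ away | inj₁ home′ = ⊥-elim (no-difference C′ C sur (sym same) s home′ away)

module Touching (k : ℕ) (γ : ℕ → Bool) where

  open Cycle k
  open Run k γ

  Exchanged : Fin (suc (suc k)) → Fin (suc (suc k)) → ℕ → Set
  Exchanged u v i = γ i ≡ false × ((hand i ≡ u × slot i (σ i) ≡ v) ⊎ (hand i ≡ v × slot i (σ i) ≡ u))

  exchanged? : ∀ u v i → Dec (Exchanged u v i)
  exchanged? u v i = γ i Bool.≟ false ×-dec
    ((hand i Fin.≟ u ×-dec slot i (σ i) Fin.≟ v) ⊎-dec (hand i Fin.≟ v ×-dec slot i (σ i) Fin.≟ u))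

  Touched : ℕ → Fin (suc (suc k)) → Fin (suc (suc k)) → Set
  Touched N u v = ∃ λ i → i < N × Exchanged u v i

module Valid (k : ℕ) (γ : ℕ → Bool)
  {N : ℕ} (N≡ : N ≡ suc (suc k) * suc k)
  (closed : ∀ ℓ → Run.conf k γ N ℓ ≡ ℓ) (met≡ : ∀ o → Run.met k γ N o ≡ suc k)
  (skips≡ : count (λ i → γ i Bool.≟ false) N ≡ suc k * 2) where

  open Cycle k
  open Run k γ
  open Touching k γ

  Skip : Fin (suc k) → ℕ → Set
  Skip s i = γ i ≡ false × σ i ≡ s

  skip? : ∀ s i → Dec (Skip s i)
  skip? s i = γ i Bool.≟ false ×-dec σ i Fin.≟ s

  swaps : Fin (suc k) → ℕ → ℕ
  swaps s = count (skip? s)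

  slot-idle : ∀ {s i} → ¬ Skip s i → slot (suc i) s ≡ slot i s
  slot-idle {s} {i} idle with s Fin.≟ σ i | γ i in γi
  ... | no s≢σ   | b     = trans (cong (λ b → conf i (move b (σ i) (suc s))) (sym γi)) (slot-other {i} s≢σ)
  ... | yes refl | true  = refl
  ... | yes refl | false = contradiction (refl , refl) idle

  slot-received : ∀ {s i} → Skip s i → slot (suc i) s ≡ hand i
  slot-received {i = i} (γi , refl) = skipped-slot {i} γi

  slot-constant : ∀ {s i} j → i ≤ j → swaps s i ≡ swaps s j → slot i s ≡ slot j s
  slot-constant zero    z≤n eq = refl
  slot-constant {s} {i} (suc j) i≤1+j eq with ℕ.m≤n⇒m<n∨m≡n i≤1+j
  ... | inj₂ refl = refl
  ... | inj₁ (s≤s i≤j) with skip? s j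
  ...   | yes _   = contradiction eq (ℕ.<⇒≢ (s≤s (count-mono (skip? s) i≤j)))
  ...   | no idle = trans (slot-constant j i≤j eq) (sym (slot-idle idle))

  slot-before : ∀ {s i} → swaps s i ≡ 0 → slot i s ≡ suc s
  slot-before {s} {i} eq = sym (slot-constant i z≤n (sym eq))

  slot-after : ∀ {s i} → i ≤ N → swaps s i ≡ swaps s N → slot i s ≡ suc s
  slot-after {s} i≤N eq = trans (slot-constant N i≤N eq) (closed (suc s))

  swaps≢0 : ∀ s → swaps s N ≢ 0
  swaps≢0 s none = ℕ.1+n≢n (begin
    suc (suc k)                                ≡⟨ visits (suc (suc k)) N≡ s ⟨
    count (λ i → σ i Fin.≟ s) N                ≡⟨ ∑<-cong N (λ i i<N → ⟦⟧-cong (σ i Fin.≟ s) (slot i (σ i) Fin.≟ suc s)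
                                                    (λ { refl → home i<N })
                                                    (λ eq → Fin.suc-injective (conf-injective i (trans eq (sym (home i<N)))))) ⟩
    met N (suc s)                              ≡⟨ met≡ (suc s) ⟩
    suc k                                      ∎)
    where
    open ≡-Reasoning
    home : ∀ {i} → i < N → slot i s ≡ suc s
    home {i} i<N = slot-before {i = i} (ℕ.n≤0⇒n≡0 (subst (swaps s i ≤_) none (count-mono (skip? s) (ℕ.<⇒≤ i<N))))

  -- After a single exchange the slot would have to hold its own object again, received from the
  -- hand; but just before, that object lay in the slot.
  swaps≢1 : ∀ s → swaps s N ≢ 1
  swaps≢1 s one with count-reaches (skip? s) {0} N (subst (0 <_) (sym one) (s≤s z≤n))
  ... | i , i<N , i₀ , skip = contradiction (conf-injective i (begin
    hand i          ≡⟨ slot-received {i = i} skip ⟨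
    slot (suc i) s  ≡⟨ slot-after {i = suc i} i<N (trans (trans (count-yes (skip? s) skip) (cong suc i₀)) (sym one)) ⟩
    suc s           ≡⟨ slot-before {i = i} i₀ ⟨
    slot i s        ∎)) λ ()
    where open ≡-Reasoning

  -- Every slot needs at least two exchanges, and the number of skips allows no more.
  swaps≡2 : ∀ s → swaps s N ≡ 2
  swaps≡2 = sum-squeeze (λ s → swaps s N) (λ s → ≥2 (swaps≢0 s) (swaps≢1 s)) (begin
    sum (λ s → swaps s N)                        ≡⟨ ∑<-sum N (λ i s → ⟦ skip? s i ⟧) ⟨
    ∑< N (λ i → sum λ s → ⟦ skip? s i ⟧)         ≡⟨ ∑<-cong N (λ i _ → sum-×≟ (γ i Bool.≟ false) (σ i)) ⟩
    count (λ i → γ i Bool.≟ false) N             ≡⟨ skips≡ ⟩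
    suc k * 2                                    ∎)
    where
    open ≡-Reasoning
    ≥2 : ∀ {a} → a ≢ 0 → a ≢ 1 → 2 ≤ a
    ≥2 {zero}        a≢0 _   = contradiction refl a≢0
    ≥2 {suc zero}    _   a≢1 = contradiction refl a≢1
    ≥2 {suc (suc a)} _   _   = s≤s (s≤s z≤n)

  opening : ∀ s → ∃ λ i → i < N × swaps s i ≡ 0 × Skip s i
  opening s = count-reaches (skip? s) N (subst (0 <_) (sym (swaps≡2 s)) (s≤s z≤n))

  closing : ∀ s → ∃ λ i → i < N × swaps s i ≡ 1 × Skip s i
  closing s = count-reaches (skip? s) N (subst (1 <_) (sym (swaps≡2 s)) (s≤s (s≤s z≤n)))

  op cl : Fin (suc k) → ℕ
  op s = proj₁ (opening s)
  cl s = proj₁ (closing s)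

  -- The parent is what the slot receives at its first exchange and keeps until the second.
  q : Fin (suc k) → Fin (suc (suc k))
  q s = hand (op s)

  swaps-1+op : ∀ s → swaps s (suc (op s)) ≡ 1
  swaps-1+op s = let (_ , _ , op₀ , skip) = opening s in trans (count-yes (skip? s) skip) (cong suc op₀)

  slot-between : ∀ {s i} → swaps s i ≡ 1 → slot i s ≡ q s
  slot-between {s} {i} eq = trans same (slot-received {i = op s} (proj₂ (proj₂ (proj₂ (opening s)))))
    where
    same : slot i s ≡ slot (suc (op s)) s
    same with ℕ.≤-total i (suc (op s))
    ... | inj₁ ≤op = slot-constant (suc (op s)) ≤op (trans eq (sym (swaps-1+op s)))
    ... | inj₂ op≤ = sym (slot-constant i op≤ (trans (swaps-1+op s) (sym eq)))

  placed : ∀ {i} → i ≤ N → ∀ s → slot i s ≡ suc s ⊎ slot i s ≡ q s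
  placed {i} i≤N s with swaps s i in eq | subst (swaps s i ≤_) (swaps≡2 s) (count-mono (skip? s) i≤N)
  ... | 0 | _ = inj₁ (slot-before {i = i} eq)
  ... | 1 | _ = inj₂ (slot-between {i = i} eq)
  ... | 2 | _ = inj₁ (slot-after {i = i} i≤N (trans eq (sym (swaps≡2 s))))
  ... | suc (suc (suc _)) | s≤s (s≤s ())

  -- An object that the hand brings to another slot must have left its own slot before.
  op-< : ∀ {s t} → q s ≡ suc t → op t < op s
  op-< {s} {t} eq with op s ℕ.≤? op t
  ... | no  s≰t = ℕ.≰⇒> s≰t
  ... | yes s≤t = contradiction (conf-injective (op s) (trans eq (sym (slot-before {i = op s} home)))) λ ()
    where
    home : swaps t (op s) ≡ 0
    home = ℕ.n≤0⇒n≡0 (subst (swaps t (op s) ≤_) (proj₁ (proj₂ (proj₂ (opening t)))) (count-mono (skip? t) s≤t))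

  open Edges q

  ranked : Ranked
  ranked = record { rank = op ; rank-< = op-< }

  open Configurations ranked

  configuration : ∀ {i} → i ≤ N → IsConfiguration (conf i)
  configuration {i} i≤N = record { injective = conf-injective i ; placed = placed i≤N }

  closing-held : ∀ {s i} → i < N → swaps s i ≡ 1 → Skip s i → hand i ≡ suc s
  closing-held {s} {i} i<N one skip = trans (sym (slot-received {i = i} skip))
    (slot-after {i = suc i} i<N (trans (count-yes (skip? s) skip) (trans (cong suc one) (sym (swaps≡2 s)))))

  hand-cl : ∀ s → hand (cl s) ≡ suc s
  hand-cl s = let (_ , i<N , one , skip) = closing s in closing-held i<N one skip

  held : ∀ h → ∃ λ i → i < N × hand i ≡ h
  held zero    = 0 , subst (0 <_) (sym N≡) (s≤s z≤n) , refl
  held (suc s) = cl s , proj₁ (proj₂ (closing s)) , hand-cl s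

  meetings≡1 : ∀ h s → meetings N h s ≡ 1
  meetings≡1 h s = sum-squeeze (λ h → meetings N h s) ≥1
    (trans (meetings-sum (suc (suc k)) N≡ s) (sym (ℕ.*-identityʳ (suc (suc k))))) h
    where
    ≥1 : ∀ h → 1 ≤ meetings N h s
    -- Being held at some time `i` gives `h` a meeting with slot `σ i`, and constancy around the
    -- cycle carries it over to `s`.
    ≥1 h = let (i , i<N , hi) = held h in
      subst (1 ≤_) (meetings-constant (suc (suc k)) N≡ closed h (σ i) s)
        (count≥1 (λ i′ → hand i′ Fin.≟ h ×-dec σ i′ Fin.≟ σ i) i<N (hi , refl))

  meeting-unique : ∀ {i j} → i < N → j < N → hand i ≡ hand j → σ i ≡ σ j → i ≡ j
  meeting-unique {i} {j} i<N j<N hi σi =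
    count≡1⇒unique (λ i′ → hand i′ Fin.≟ hand j ×-dec σ i′ Fin.≟ σ j) {N}
      (meetings≡1 (hand j) (σ j)) i<N j<N (hi , σi) (refl , refl)

  -- The first exchange of a slot trades the child for the parent, the second reverses this, and
  -- there is no third.
  skip⇒edge : ∀ {i} → i < N → γ i ≡ false → hand i — slot i (σ i)
  skip⇒edge {i} i<N γi
    with swaps (σ i) i in eq | subst₂ _≤_ (count-yes (skip? (σ i)) (γi , refl)) (swaps≡2 (σ i)) (count-mono (skip? (σ i)) i<N)
  ... | 0 | _ = inj₁ (σ i , trans (sym (slot-received {i = i} (γi , refl)))
                              (slot-between {i = suc i} (trans (count-yes (skip? (σ i)) (γi , refl)) (cong suc eq)))
                          , slot-before {i = i} eq)
  ... | 1 | _ = inj₂ (σ i , slot-between {i = i} eq , closing-held i<N eq (γi , refl))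
  ... | suc (suc _) | s≤s (s≤s ())

  touched⇒edge : ∀ {u v} → Touched N u v → u — v
  touched⇒edge (i , i<N , γi , inj₁ (refl , refl)) = skip⇒edge i<N γi
  touched⇒edge (i , i<N , γi , inj₂ (refl , refl)) = —-sym (skip⇒edge i<N γi)

  edge⇒touched : ∀ {u v} → u — v → Touched N u v
  edge⇒touched (inj₁ (s , refl , refl)) = let (i , i<N , op₀ , γi , σi) = opening s in
    i , i<N , γi , inj₁ (refl , trans (cong (slot i) σi) (slot-before {i = i} op₀))
  edge⇒touched (inj₂ (s , refl , refl)) = let (i , i<N , op₀ , γi , σi) = opening s in
    i , i<N , γi , inj₂ (refl , trans (cong (slot i) σi) (slot-before {i = i} op₀))

  -- Adjacent objects meet at the slot of the child, which the hand visits only once with each of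
  -- them. These two visits are the first and second exchange, hence skips.
  taken⇒untouched : ∀ {i} → i < N → γ i ≡ true → ¬ (hand i — slot i (σ i))
  taken⇒untouched {i} i<N γi edge with IsConfiguration.meet (configuration (ℕ.<⇒≤ i<N)) (σ i) edge
  ... | inj₁ (hi , _) = absurd (closing (σ i)) (trans hi (sym (hand-cl (σ i))))
    where
    absurd : (c : ∃ λ j → j < N × swaps (σ i) j ≡ 1 × Skip (σ i) j) → hand i ≡ hand (proj₁ c) → ⊥
    absurd (j , j<N , _ , γj , σj) hi with refl ← meeting-unique i<N j<N hi (sym σj) with trans (sym γi) γj
    ... | ()
  ... | inj₂ (hi , _) = absurd (opening (σ i)) hi
    where
    absurd : (c : ∃ λ j → j < N × swaps (σ i) j ≡ 0 × Skip (σ i) j) → hand i ≡ hand (proj₁ c) → ⊥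
    absurd (j , j<N , _ , γj , σj) hi with refl ← meeting-unique i<N j<N hi (sym σj) with trans (sym γi) γj
    ... | ()

-- From trees to words

module Exploration (k : ℕ) {q : Fin (suc k) → Fin (suc (suc k))} (ranked : Edges.Ranked q)
  (γ : ℕ → Bool)
  {N : ℕ} (N≡ : N ≡ suc (suc k) * suc k)
  (skip⇒edge : ∀ i → γ i ≡ false → Edges._—_ q (Run.hand k γ i) (Run.slot k γ i (Cycle.σ k i)))
  (edge⇒skip : ∀ i → Edges._—_ q (Run.hand k γ i) (Run.slot k γ i (Cycle.σ k i)) → γ i ≡ false) where

  open Edges q
  open Cycle k
  open Run k γ
  open Ranked ranked
  open Configurations ranked
  open Touching k γ

  configuration : ∀ i → IsConfiguration (conf i)
  configuration zero = record { injective = λ eq → eq ; placed = λ _ → inj₁ refl }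
  configuration (suc i) = record { injective = conf-injective (suc i) ; placed = placed }
    where
    module C = IsConfiguration (configuration i)
    placed : ∀ s → slot (suc i) s ≡ suc s ⊎ slot (suc i) s ≡ q s
    placed s with s Fin.≟ σ i | γ i in γi
    ... | no s≢σ   | b    = subst (λ o → o ≡ suc s ⊎ o ≡ q s)
                              (trans (sym (slot-other {i} s≢σ)) (cong (λ b → conf i (move b (σ i) (suc s))) γi)) (C.placed s)
    ... | yes refl | true = C.placed s
    ... | yes refl | false with C.meet s (skip⇒edge i γi)
    ...   | inj₁ (held , _) = inj₁ (trans (cong (conf i) (transpose-j zero (suc s))) held)
    ...   | inj₂ (held , _) = inj₂ (trans (cong (conf i) (transpose-j zero (suc s))) held)

  same-hand : ∀ {i j} → hand i ≡ hand j → ∀ ℓ → conf i ℓ ≡ conf j ℓ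
  same-hand {i} {j} = configuration-unique (configuration i) (configuration j) (conf-surjective i) (conf-surjective j)

  child-held⇒skip : ∀ {s} i → hand i ≡ suc s → σ i ≡ s → γ i ≡ false
  child-held⇒skip i held refl = edge⇒skip i (inj₂ (σ i , IsConfiguration.held⇒parent-in-slot (configuration i) held , held))

  parent-held⇒skip : ∀ {s} i → hand i ≡ q s → σ i ≡ s → γ i ≡ false
  parent-held⇒skip i held refl = edge⇒skip i (inj₁ (σ i , held , IsConfiguration.parent-held⇒in-slot (configuration i) held))

  τ : Fin (suc k) → Fin (suc (suc k)) → Fin (suc (suc k))
  τ s = transpose (suc s) (q s)

  -- The hand moves independently of the rest of the arrangement: it crosses the tree edge of the
  -- slot exactly when it holds one of its ends.
  hand-suc : ∀ i → hand (suc i) ≡ τ (σ i) (hand i)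
  hand-suc i = go (γ i) refl
    where
    open ≡-Reasoning
    go : ∀ b → γ i ≡ b → hand (suc i) ≡ τ (σ i) (hand i)
    go true γi = trans (taken {i} γi zero) (sym (transpose-other (suc (σ i)) (q (σ i))
      (λ held → contradiction (trans (sym γi) (child-held⇒skip i held refl)) λ ())
      (λ held → contradiction (trans (sym γi) (parent-held⇒skip i held refl)) λ ())))
    go false γi with IsConfiguration.meet (configuration i) (σ i) (skip⇒edge i γi)
    ... | inj₁ (held , away) = begin
      hand (suc i)        ≡⟨ skipped-hand {i} γi ⟩
      slot i (σ i)        ≡⟨ away ⟩
      q (σ i)             ≡⟨ transpose-i (suc (σ i)) (q (σ i)) ⟨
      τ (σ i) (suc (σ i)) ≡⟨ cong (τ (σ i)) held ⟨
      τ (σ i) (hand i)    ∎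
    ... | inj₂ (held , home) = begin
      hand (suc i)        ≡⟨ skipped-hand {i} γi ⟩
      slot i (σ i)        ≡⟨ home ⟩
      suc (σ i)           ≡⟨ transpose-j (suc (σ i)) (q (σ i)) ⟨
      τ (σ i) (q (σ i))   ≡⟨ cong (τ (σ i)) held ⟨
      τ (σ i) (hand i)    ∎

  State : Set
  State = Fin (suc (suc k)) × Fin (suc k)

  next : State → State
  next (h , s) = τ s h , prev s

  next-injective : ∀ {x y} → next x ≡ next y → x ≡ y
  next-injective {h , s} {h′ , s′} eq with refl ← prev-injective {s} {s′} (cong proj₂ eq) =
    cong (_, s) (transpose-injective (suc s) (q s) (cong proj₁ eq))

  state : ℕ → State
  state i = hand i , σ i

  state-suc : ∀ i → state (suc i) ≡ next (state i)
  state-suc i = cong (_, prev (σ i)) (hand-suc i)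

  -- The transpositions along the edges of a tree, in any order, multiply to a full cycle.
  module _ {B : Set} (φ : State → B) (invariant : ∀ x → φ x ≡ φ (next x)) where

    open ≡-Reasoning

    -- If `h` is the parent of `suc t`, the hand changes to the child, runs through the subtree
    -- until it is back at slot `t`, and changes to `h` again. If `h` is no end of the edge, it just
    -- passes.
    pass : ∀ h → (∀ t → q t ≡ h → φ (suc t , prev t) ≡ φ (suc t , t)) →
           ∀ t → h ≢ suc t → φ (h , t) ≡ φ (h , prev t)
    pass h loops t h≢ with h Fin.≟ q t
    ... | no h≢q  = trans (invariant (h , t)) (cong (λ h → φ (h , prev t)) (transpose-other (suc t) (q t) h≢ h≢q))
    ... | yes refl = begin
      φ (q t , t)               ≡⟨ invariant (q t , t) ⟩
      φ (τ t (q t) , prev t)    ≡⟨ cong (λ h → φ (h , prev t)) (transpose-j (suc t) (q t)) ⟩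
      φ (suc t , prev t)        ≡⟨ loops t refl ⟩
      φ (suc t , t)             ≡⟨ invariant (suc t , t) ⟩
      φ (τ t (suc t) , prev t)  ≡⟨ cong (λ h → φ (h , prev t)) (transpose-i (suc t) (q t)) ⟩
      φ (q t , prev t)          ∎

    node : ∀ s → (∀ t → q t ≡ suc s → φ (suc t , prev t) ≡ φ (suc t , t)) → ∀ t u → φ (suc s , t) ≡ φ (suc s , u)
    node s loops = prev-constant (λ t → φ (suc s , t)) s
      (λ t t≢s → pass (suc s) loops t (t≢s ∘ sym ∘ Fin.suc-injective))

    -- The excursion into the subtree of `suc s`: by induction the excursions to its children
    -- return, so the hand holding `suc s` gets round all slots back to its own.
    loop : ∀ s → φ (suc s , prev s) ≡ φ (suc s , s)
    loop = children-induction λ s loops → node s loops (prev s) s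

    -- The root passes every slot, since it has no slot of its own. Every other object is linked to
    -- its parent by the step at its own slot.
    invariant-constant : ∀ h t u → φ (h , t) ≡ φ (zero , u)
    invariant-constant = parent-induction
      (prev-constant (λ t → φ (zero , t)) zero (λ t _ → pass zero (λ t _ → loop t) t λ ()))
      (λ s ih t u → begin
        φ (suc s , t)              ≡⟨ node s (λ t _ → loop t) t (prev s) ⟩
        φ (suc s , prev s)         ≡⟨ cong (λ h → φ (h , prev s)) (transpose-j (suc s) (q s)) ⟨
        φ (τ s (q s) , prev s)     ≡⟨ invariant (q s , s) ⟨
        φ (q s , s)                ≡⟨ ih s u ⟩
        φ (zero , u)               ∎)

  _≟ₛ_ : (x y : State) → Dec (x ≡ y)
  _≟ₛ_ = Product.≡-dec Fin._≟_ Fin._≟_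

  module Period (L : ℕ) (period : state (suc L) ≡ state 0) where

    Visited : State → Set
    Visited x = ∃ λ i → i < suc L × state i ≡ x

    visited? : ∀ x → Dec (Visited x)
    visited? x = anyUpTo? (λ i → state i ≟ₛ x) (suc L)

    forward : ∀ {x} → Visited x → Visited (next x)
    forward (i , s≤s i≤L , refl) with ℕ.m≤n⇒m<n∨m≡n i≤L
    ... | inj₁ i<L  = suc i , s≤s i<L , state-suc i
    ... | inj₂ refl = 0 , s≤s z≤n , trans (sym period) (state-suc i)

    backward : ∀ {x} → Visited (next x) → Visited x
    backward (zero  , _       , eq) = L , ℕ.≤-refl , next-injective (trans (sym (state-suc L)) (trans period eq))
    backward (suc i , s≤s i<L , eq) = i , ℕ.m<n⇒m<1+n i<L , next-injective (trans (sym (state-suc i)) eq)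

    all-visited : ∀ x → Visited x
    -- Being visited is a Boolean invariant of `next`, hence constant, and it holds at the start.
    all-visited (h , s) = decidable-stable (visited? (h , s)) λ unvisited →
      contradiction
        (trans (sym (dec-false (visited? (h , s)) unvisited))
          (trans (invariant-constant (λ x → does (visited? x)) (λ x → does-⇔ (mk⇔ forward backward) (visited? x) (visited? (next x))) h s (σ 0))
                 (dec-true (visited? (state 0)) (0 , s≤s z≤n , refl))))
        λ ()

    -- Choosing a visiting time for each of the `N` states embeds the states into one period.
    period-≥ : N ≤ suc L
    period-≥ = subst (_≤ suc L) (sym N≡) (Fin.injective⇒≤ {f = index} index-injective)
      where
      index : Fin (suc (suc k) * suc k) → Fin (suc L)
      index x = fromℕ< (proj₁ (proj₂ (all-visited (remQuot (suc k) x))))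
      index-injective : ∀ {x y} → index x ≡ index y → x ≡ y
      index-injective {x} {y} eq = begin
        x                               ≡⟨ Fin.combine-remQuot {suc (suc k)} (suc k) x ⟨
        uncurry combine (remQuot {suc (suc k)} (suc k) x)   ≡⟨ cong (uncurry (combine {suc (suc k)})) same ⟩
        uncurry combine (remQuot {suc (suc k)} (suc k) y)   ≡⟨ Fin.combine-remQuot {suc (suc k)} (suc k) y ⟩
        y                               ∎
        where
        open ≡-Reasoning
        same : remQuot {suc (suc k)} (suc k) x ≡ remQuot (suc k) y
        same = let (_ , i< , ix) = all-visited (remQuot (suc k) x) ; (_ , j< , jy) = all-visited (remQuot (suc k) y)
               in trans (sym ix) (trans (cong state (Fin.fromℕ<-injective _ _ i< j< eq)) jy)

  return : ∀ i {d} → state (i + d) ≡ state i → state d ≡ state 0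
  return zero    eq = eq
  return (suc i) {d} eq = return i {d} (next-injective (trans (sym (state-suc (i + d))) (trans eq (state-suc i))))

  return-late : ∀ {i j} → i < j → state i ≡ state j → N + i ≤ j
  return-late {i} {j} i<j eq with ℕ.m≤n⇒∃[o]m+o≡n i<j
  ... | d , refl = ℕ.≤-trans
    (ℕ.+-monoˡ-≤ i (Period.period-≥ d (return i {suc d} (trans (cong state (ℕ.+-suc i d)) (sym eq)))))
    (ℕ.≤-reflexive (cong suc (ℕ.+-comm d i)))

  abstract

    -- Among the times from zero to `N` two share a state. Repetitions are at least `N` apart, so
    -- these times are zero and `N`.
    state-period : state N ≡ state 0
    state-period with Fin.pigeonhole (s≤s (ℕ.≤-reflexive (sym N≡))) (λ i → uncurry combine (state (toℕ i)))
    ... | i , j , i<j , eq = trans (cong state (sym j≡N)) (trans (sym states≡) (cong state i≡0))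
      where
      states≡ : state (toℕ i) ≡ state (toℕ j)
      states≡ = let (h≡ , s≡) = Fin.combine-injective _ _ _ _ eq in cong₂ _,_ h≡ s≡
      late : N + toℕ i ≤ toℕ j
      late = return-late i<j states≡
      j≤N : toℕ j ≤ N
      j≤N = ℕ.≤-pred (Fin.toℕ<n j)
      i≡0 : toℕ i ≡ 0
      i≡0 = ℕ.n≤0⇒n≡0 (ℕ.+-cancelˡ-≤ N _ _ (ℕ.≤-trans late (ℕ.≤-trans j≤N (ℕ.≤-reflexive (sym (ℕ.+-identityʳ N))))))
      j≡N : toℕ j ≡ N
      j≡N = ℕ.≤-antisym j≤N (ℕ.≤-trans (ℕ.m≤m+n N (toℕ i)) late)

    visit : ∀ h s → ∃ λ i → i < N × hand i ≡ h × σ i ≡ s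
    visit h s = let (i , i<N , eq) = Period.all-visited _ (trans (cong state (sym N≡)) state-period) (h , s) in i , subst (i <_) (sym N≡) i<N , cong proj₁ eq , cong proj₂ eq

    visit-unique : ∀ {i j} → i < N → j < N → hand i ≡ hand j → σ i ≡ σ j → i ≡ j
    visit-unique {i} {j} i<N j<N h≡ s≡ with ℕ.<-cmp i j
    ... | tri≈ _ i≡j _ = i≡j
    ... | tri< i<j _ _ = contradiction (ℕ.≤-trans (ℕ.m≤m+n N i) (return-late i<j (cong₂ _,_ h≡ s≡))) (ℕ.<⇒≱ j<N)
    ... | tri> _ _ j<i = contradiction (ℕ.≤-trans (ℕ.m≤m+n N j) (return-late j<i (cong₂ _,_ (sym h≡) (sym s≡)))) (ℕ.<⇒≱ i<N)

  closed : ∀ ℓ → conf N ℓ ≡ ℓ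
  closed = same-hand {N} {0} (cong proj₁ state-period)

  -- Each `h` other than `o` meets `o` once: the place of `o` depends only on `h` being held, and
  -- `h` visits that slot once. A diagonal term for `h = o` makes every summand one.
  met≡ : ∀ o → met N o ≡ suc k
  met≡ o = ℕ.suc-injective (begin
    suc (met N o)                                        ≡⟨ ℕ.+-comm 1 _ ⟩
    met N o + 1                                          ≡⟨ cong₂ _+_ sum-met (sum-⟦≟⟧ o) ⟨
    sum met-by + sum (λ h → ⟦ o Fin.≟ h ⟧)               ≡⟨ ∑-distrib-+ met-by (λ h → ⟦ o Fin.≟ h ⟧) ⟨
    sum (λ h → met-by h + ⟦ o Fin.≟ h ⟧)                 ≡⟨ sum-cong-≗ met-by-each ⟩
    sum {suc (suc k)} (λ _ → 1)                          ≡⟨ sum-const (suc (suc k)) 1 ⟩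
    suc (suc k) * 1                                      ≡⟨ ℕ.*-identityʳ _ ⟩
    suc (suc k)                                          ∎)
    where
    open ≡-Reasoning
    by? : ∀ h i → Dec (slot i (σ i) ≡ o × hand i ≡ h)
    by? h i = slot i (σ i) Fin.≟ o ×-dec hand i Fin.≟ h
    met-by : Fin (suc (suc k)) → ℕ
    met-by h = count (by? h) N
    sum-met : sum met-by ≡ met N o
    sum-met = trans (sym (∑<-sum N (λ i h → ⟦ by? h i ⟧)))
      (∑<-cong N λ i _ → sum-×≟ (slot i (σ i) Fin.≟ o) (hand i))
    met-once : ∀ h → o ≢ h → met-by h ≡ 1
    -- Any visit of `h` shows where `o` lies while `h` is held; the one to slot `zero` is an
    -- arbitrary choice.
    met-once h o≢h with visit h zero
    ... | i₀ , _ , refl , _ with conf-surjective i₀ o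
    ...   | zero  , held = contradiction (sym held) o≢h
    ...   | suc s , in-s with visit h s
    ...     | i , i<N , hi , refl = count-one (by? h) i<N (in-slot , hi) λ j j<N (in-j , hj) →
      let hi≡hj = trans hi (sym hj) in
      visit-unique i<N j<N hi≡hj (Fin.suc-injective (conf-injective j
        (trans (trans (sym (same-hand {i} {j} hi≡hj (suc (σ i)))) in-slot) (sym in-j))))
      where
      in-slot : slot i (σ i) ≡ o
      in-slot = trans (same-hand {i} {i₀} hi (suc (σ i))) in-s
    met-by-each : ∀ h → met-by h + ⟦ o Fin.≟ h ⟧ ≡ 1
    met-by-each h with o Fin.≟ h
    ... | yes refl = cong (_+ 1) (count-none (by? h) N λ i _ (in-i , hi) →
                       contradiction (conf-injective i (trans in-i (sym hi))) λ ())
    ... | no  o≢h  = trans (ℕ.+-identityʳ _) (met-once h o≢h)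

  -- A slot is skipped exactly when the hand holds its child or its parent, which are distinct, and
  -- each of them comes by once.
  skips≡ : count (λ i → γ i Bool.≟ false) N ≡ suc k * 2
  skips≡ = begin
    count (λ i → γ i Bool.≟ false) N                                   ≡⟨ ∑<-cong N (λ i _ → sum-×≟ (γ i Bool.≟ false) (σ i)) ⟨
    ∑< N (λ i → sum λ s → ⟦ γ i Bool.≟ false ×-dec σ i Fin.≟ s ⟧)      ≡⟨ ∑<-sum N (λ i s → ⟦ γ i Bool.≟ false ×-dec σ i Fin.≟ s ⟧) ⟩
    sum (λ s → count (λ i → γ i Bool.≟ false ×-dec σ i Fin.≟ s) N)     ≡⟨ sum-cong-≗ two ⟩
    sum {suc k} (λ _ → 2)                                              ≡⟨ sum-const (suc k) 2 ⟩
    suc k * 2                                                          ∎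
    where
    open ≡-Reasoning
    once : ∀ h s → meetings N h s ≡ 1
    once h s = let (i , i<N , hi , si) = visit h s in
      count-one (λ i → hand i Fin.≟ h ×-dec σ i Fin.≟ s) i<N (hi , si)
        λ j j<N (hj , sj) → visit-unique i<N j<N (trans hi (sym hj)) (trans si (sym sj))
    two : ∀ s → count (λ i → γ i Bool.≟ false ×-dec σ i Fin.≟ s) N ≡ 2
    two s = begin
      count (λ i → γ i Bool.≟ false ×-dec σ i Fin.≟ s) N
        ≡⟨ ∑<-cong N (λ i _ → trans
             (⟦⟧-cong (γ i Bool.≟ false ×-dec σ i Fin.≟ s) (at-child? i ⊎-dec at-parent? i) (held i) (skip i))
             (⟦⟧-⊎ (at-child? i) (at-parent? i) λ ((c , _) , (p , _)) → ↓-irrefl (s , trans (sym c) p , refl))) ⟩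
      ∑< N (λ i → ⟦ at-child? i ⟧ + ⟦ at-parent? i ⟧)
        ≡⟨ ∑<-+ N (λ i → ⟦ at-child? i ⟧) (λ i → ⟦ at-parent? i ⟧) ⟩
      meetings N (suc s) s + meetings N (q s) s
        ≡⟨ cong₂ _+_ (once (suc s) s) (once (q s) s) ⟩
      2 ∎
      where
      at-child? : ∀ i → Dec (hand i ≡ suc s × σ i ≡ s)
      at-child? i = hand i Fin.≟ suc s ×-dec σ i Fin.≟ s
      at-parent? : ∀ i → Dec (hand i ≡ q s × σ i ≡ s)
      at-parent? i = hand i Fin.≟ q s ×-dec σ i Fin.≟ s
      held : ∀ i → γ i ≡ false × σ i ≡ s → (hand i ≡ suc s × σ i ≡ s) ⊎ (hand i ≡ q s × σ i ≡ s)
      held i (γi , refl) with IsConfiguration.meet (configuration i) (σ i) (skip⇒edge i γi)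
      ... | inj₁ (h , _) = inj₁ (h , refl)
      ... | inj₂ (h , _) = inj₂ (h , refl)
      skip : ∀ i → (hand i ≡ suc s × σ i ≡ s) ⊎ (hand i ≡ q s × σ i ≡ s) → γ i ≡ false × σ i ≡ s
      skip i (inj₁ (h , si)) = child-held⇒skip i h si , si
      skip i (inj₂ (h , si)) = parent-held⇒skip i h si , si

  touched⇒edge : ∀ {u v} → Touched N u v → u — v
  touched⇒edge (i , _ , γi , inj₁ (refl , refl)) = skip⇒edge i γi
  touched⇒edge (i , _ , γi , inj₂ (refl , refl)) = —-sym (skip⇒edge i γi)

  edge⇒touched : ∀ {u v} → u — v → Touched N u v
  edge⇒touched (inj₁ (s , refl , refl)) with visit (suc s) s
  ... | i , i<N , held , refl = i , i<N , child-held⇒skip i held refl ,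
    inj₂ (held , IsConfiguration.held⇒parent-in-slot (configuration i) held)
  edge⇒touched (inj₂ (s , refl , refl)) with visit (suc s) s
  ... | i , i<N , held , refl = i , i<N , child-held⇒skip i held refl ,
    inj₁ (held , IsConfiguration.held⇒parent-in-slot (configuration i) held)

-- The bijection

fromBits-cong : ∀ i {γ γ′} → (∀ j → j < i → γ j ≡ γ′ j) → fromBits i γ ≡ fromBits i γ′
fromBits-cong zero    eq = refl
fromBits-cong (suc i) eq = cong₂ _∷_ (eq i ℕ.≤-refl) (fromBits-cong i λ j → eq j ∘ ℕ.m<n⇒m<1+n)

skips-fromBits : ∀ i γ → skips (fromBits i γ) ≡ count (λ j → γ j Bool.≟ false) i
skips-fromBits zero    γ = refl
skips-fromBits (suc i) γ with γ i
... | true  = skips-fromBits i γ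
... | false = cong suc (skips-fromBits i γ)

-- Indexed from the right end of the word; the value beyond its left end is junk.
bits : ∀ {i} → Vec Bool i → ℕ → Bool
bits []               j = true
bits {suc i} (b ∷ bs) j = if does (j ≟ i) then b else bits bs j

fromBits-bits : ∀ {i} (w : Vec Bool i) → fromBits i (bits w) ≡ w
fromBits-bits []               = refl
fromBits-bits {suc i} (b ∷ bs) = cong₂ _∷_
  (cong (if_then b else bits bs i) (dec-true (i ≟ i) refl))
  (trans (fromBits-cong i λ j j<i → cong (if_then b else bits bs j) (dec-false (j ≟ i) (ℕ.<⇒≢ j<i)))
         (fromBits-bits bs))

bits-fromBits : ∀ i γ j → j < i → bits (fromBits i γ) j ≡ γ j
bits-fromBits (suc i) γ j (s≤s j≤i) with j ≟ i
... | yes refl = cong (if_then γ i else bits (fromBits i γ) i) (dec-true (i ≟ i) refl)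
... | no  j≢i  = trans (cong (if_then γ i else bits (fromBits i γ) j) (dec-false (j ≟ i) j≢i))
                       (bits-fromBits i γ j (ℕ.≤∧≢⇒< j≤i j≢i))

conf-cong : ∀ k {γ γ′} i → (∀ j → j < i → γ j ≡ γ′ j) → ∀ ℓ → Run.conf k γ i ℓ ≡ Run.conf k γ′ i ℓ
conf-cong k zero    eq ℓ = refl
conf-cong k {γ} {γ′} (suc i) eq ℓ = trans
  (cong (λ b → Run.conf k γ i (move b (Cycle.σ k i) ℓ)) (eq i ℕ.≤-refl))
  (conf-cong k i (λ j → eq j ∘ ℕ.m<n⇒m<1+n) (move (γ′ i) (Cycle.σ k i) ℓ))

touched-cong : ∀ k {γ γ′} N → (∀ j → j < N → γ j ≡ γ′ j) → ∀ {u v} →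
               Touching.Touched k γ N u v → Touching.Touched k γ′ N u v
touched-cong k {γ} {γ′} N eq (i , i<N , γi , pair) = i , i<N , trans (sym (eq i i<N)) γi ,
  Sum.map (Product.map (same zero) (same _)) (Product.map (same zero) (same _)) pair
  where
  same : ∀ ℓ {o} → Run.conf k γ i ℓ ≡ o → Run.conf k γ′ i ℓ ≡ o
  same ℓ = trans (sym (conf-cong k i (λ j j<i → eq j (ℕ.<-trans j<i i<N)) ℓ))

-- The word of a graph skips a letter exactly when the hand is adjacent to the slot it meets.
module Greedy (k : ℕ) (A : Matrix (suc (suc k))) where

  open Cycle k

  -- Letters and arrangements are defined together, each letter depending on the arrangement left by
  -- the previous ones.
  bit : ℕ → Bool
  config : ℕ → Fin (suc (suc k)) → Fin (suc (suc k))
  bit i = not (lookup (lookup A (config i zero)) (config i (suc (σ i))))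
  config zero    ℓ = ℓ
  config (suc i) ℓ = config i (move (bit i) (σ i) ℓ)

  conf≡config : ∀ i ℓ → Run.conf k bit i ℓ ≡ config i ℓ
  conf≡config zero    ℓ = refl
  conf≡config (suc i) ℓ = conf≡config i (move (bit i) (σ i) ℓ)

  open Run k bit

  bit-conf : ∀ i → bit i ≡ not (lookup (lookup A (hand i)) (slot i (σ i)))
  bit-conf i = sym (cong₂ (λ u v → not (lookup (lookup A u) v)) (conf≡config i zero) (conf≡config i (suc (σ i))))

  skip⇒adjacent : ∀ i → bit i ≡ false → Adj A (hand i) (slot i (σ i))
  skip⇒adjacent i eq = Bool.not-injective (trans (sym (bit-conf i)) eq)

  adjacent⇒skip : ∀ i → Adj A (hand i) (slot i (σ i)) → bit i ≡ false
  adjacent⇒skip i adj = trans (bit-conf i) (cong not adj)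

module Graph (k : ℕ) (γ : ℕ → Bool) (N : ℕ) where

  open Touching k γ

  touched? : ∀ u v → Dec (Touched N u v)
  touched? u v = anyUpTo? (exchanged? u v) N

  graph : Matrix (suc (suc k))
  graph = tabulate λ u → tabulate λ v → does (touched? u v)

  lookup-graph : ∀ u v → lookup (lookup graph u) v ≡ does (touched? u v)
  lookup-graph u v = trans (cong (λ row → lookup row v) (lookup∘tabulate (λ u → tabulate (adjacent u)) u)) (lookup∘tabulate (adjacent u) v)
    where
    adjacent : Fin (suc (suc k)) → Fin (suc (suc k)) → Bool
    adjacent u v = does (touched? u v)

  touched⇒adj : ∀ {u v} → Touched N u v → Adj graph u v
  touched⇒adj {u} {v} t = trans (lookup-graph u v) (dec-true (touched? u v) t)

  adj⇒touched : ∀ {u v} → Adj graph u v → Touched N u v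
  adj⇒touched {u} {v} adj with touched? u v | lookup-graph u v
  ... | yes t | _  = t
  ... | no _  | eq = contradiction (trans (sym eq) adj) λ ()

lookup-extensional : ∀ {n} {A B : Matrix n} → (∀ u v → lookup (lookup A u) v ≡ lookup (lookup B u) v) → A ≡ B
lookup-extensional {A = A} {B} eq = trans (sym (tabulate∘lookup A)) (trans
  (tabulate-cong λ u → trans (sym (tabulate∘lookup (lookup A u))) (trans
    (tabulate-cong (eq u)) (tabulate∘lookup (lookup B u))))
  (tabulate∘lookup B))

module Bijection (k : ℕ) where

  open Cycle k

  private
    n N : ℕ
    n = suc (suc k)
    N = n * suc k

  skipNumber : 2 * n ∸ 2 ≡ suc k * 2
  skipNumber = cong (_∸ 2) (ℕ.*-comm 2 n)

  graph : Subword n → Matrix n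
  graph w = Graph.graph k (bits w) N

  module _ (w : Subword n) (skipCount : skips w ≡ 2 * n ∸ 2) (isIdentity : ∀ x → product n w x ≡ x) where

    private
      γ : ℕ → Bool
      γ = bits w
      identity : ∀ x → prodFrom n 0 (fromBits N γ) x ≡ x
      identity x = trans (cong (λ w → prodFrom n 0 w x) (fromBits-bits w)) (isIdentity x)
      module W = Valid k γ {N} refl (Affine.identity⇒closed k γ identity) (Affine.identity⇒met k γ identity)
        (trans (sym (skips-fromBits N γ)) (trans (cong skips (fromBits-bits w)) (trans skipCount skipNumber)))
      module G = Graph k γ N
      module T = ParentToTree W.ranked {graph w} (G.touched⇒adj ∘ W.edge⇒touched) (W.touched⇒edge ∘ G.adj⇒touched)

    tree : LabelledTree n
    tree = mkTree (graph w) T.symmetric T.loopless T.connected T.acyclic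

    private
      open Run k γ

      decided : ∀ i → i < N → γ i ≡ not (lookup (lookup (graph w) (hand i)) (slot i (σ i)))
      decided i i<N with γ i in γi | lookup (lookup (graph w) (hand i)) (slot i (σ i)) in adj
      ... | true  | false = refl
      ... | false | true  = refl
      ... | true  | true  = contradiction (W.touched⇒edge (G.adj⇒touched adj)) (W.taken⇒untouched i<N γi)
      ... | false | false = contradiction (trans (sym (G.touched⇒adj (i , i<N , γi , inj₁ (refl , refl)))) adj) λ ()

      open Greedy k (graph w) using (bit; conf≡config)

      -- Induction on time: the arrangement at `i` depends only on earlier letters, and with the
      -- graph it decides letter `i`.
      bits≡ : ∀ i → i ≤ N → ∀ j → j < i → γ j ≡ bit j
      bits≡ (suc i) i<N j (s≤s j≤i) with ℕ.m≤n⇒m<n∨m≡n j≤i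
      ... | inj₁ j<i  = bits≡ i (ℕ.<⇒≤ i<N) j j<i
      ... | inj₂ refl = trans (decided i i<N)
        (cong₂ (λ u v → not (lookup (lookup (graph w) u) v)) (same zero) (same (suc (σ i))))
        where
        same : ∀ ℓ → conf i ℓ ≡ Greedy.config k (graph w) i ℓ
        same ℓ = trans (conf-cong k i (bits≡ i (ℕ.<⇒≤ i<N)) ℓ) (conf≡config i ℓ)

    word-of-graph : w ≡ fromBits N (Greedy.bit k (graph w))
    word-of-graph = trans (sym (fromBits-bits w)) (fromBits-cong N (bits≡ N ℕ.≤-refl))

  module _ (A : Matrix n)
    (symmetric : ∀ i j → lookup (lookup A i) j ≡ lookup (lookup A j) i)
    (loopless : ∀ i → lookup (lookup A i) i ≡ false)
    (connected : Connected A) (acyclic : Acyclic A) where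

    private
      module T = TreeToParent {A = A} symmetric loopless connected acyclic
      open Greedy k A
      module E = Exploration k T.ranked bit {N} refl
        (λ i → T.to-edge ∘ skip⇒adjacent i) (λ i → adjacent⇒skip i ∘ T.from-edge)

    greedy-skips : skips (fromBits N bit) ≡ 2 * n ∸ 2
    greedy-skips = trans (skips-fromBits N bit) (trans E.skips≡ (sym skipNumber))

    greedy-identity : ∀ x → product n (fromBits N bit) x ≡ x
    greedy-identity = Affine.met⇒identity k bit E.closed E.met≡

    graph-of-greedy : graph (fromBits N bit) ≡ A
    graph-of-greedy = lookup-extensional λ u v → Bool.⇔→≡ {z = true} (mk⇔ (to u v) (from u v))
      where
      module G = Graph k (bits (fromBits N bit)) N
      to : ∀ u v → Adj G.graph u v → Adj A u v
      to u v = T.from-edge ∘ E.touched⇒edge ∘ touched-cong k N (bits-fromBits N bit) ∘ G.adj⇒touched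
      from : ∀ u v → Adj A u v → Adj G.graph u v
      from u v = G.touched⇒adj ∘ touched-cong k N (λ j j<N → sym (bits-fromBits N bit j j<N)) ∘ E.edge⇒touched ∘ T.to-edge

  toTree : MaxDistSubword n → LabelledTree n
  -- The irrelevant proofs are equalities of naturals and of integers, so decidability recovers them
  -- for relevant use.
  toTree (mkSub w skipCount isIdentity) = tree w (recompute (_ ≟ _) skipCount) (λ x → recompute (_ ℤ.≟ _) (isIdentity x))

  toTree-injective : ∀ {x y} → toTree x ≡ toTree y → x ≡ y
  toTree-injective {x} {y} eq = subword-≡ (trans (word-≡ x) (trans (cong (λ t → fromBits N (Greedy.bit k (LabelledTree.adj t))) eq) (sym (word-≡ y))))
    where
    subword-≡ : ∀ {x y : MaxDistSubword n} → MaxDistSubword.word x ≡ MaxDistSubword.word y → x ≡ y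
    subword-≡ refl = refl
    word-≡ : ∀ x → MaxDistSubword.word x ≡ fromBits N (Greedy.bit k (LabelledTree.adj (toTree x)))
    word-≡ (mkSub w skipCount isIdentity) = word-of-graph w (recompute (_ ≟ _) skipCount) (λ x → recompute (_ ℤ.≟ _) (isIdentity x))

  toTree-surjective : ∀ t → ∃ λ x → ∀ {y} → y ≡ x → toTree y ≡ t
  toTree-surjective (mkTree A symmetric loopless connected acyclic) =
    mkSub (fromBits N (Greedy.bit k A))
      (greedy-skips A symmetric loopless connected acyclic)
      (greedy-identity A symmetric loopless connected acyclic)
    -- Equality of matrices is decidable, so it can be recovered although the tree properties are
    -- given only irrelevantly.
    , λ { refl → tree-≡ (recompute (Vec.≡-dec (Vec.≡-dec Bool._≟_) _ _) (graph-of-greedy A symmetric loopless connected acyclic)) }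
    where
    tree-≡ : ∀ {t t′ : LabelledTree n} → LabelledTree.adj t ≡ LabelledTree.adj t′ → t ≡ t′
    tree-≡ refl = refl

theorem6p1 : (n : ℕ) .{{_ : NonZero n}} → 2 ≤ n → MaxDistSubword n ⤖ LabelledTree n
theorem6p1 (suc zero) (s≤s ())
theorem6p1 (suc (suc k)) _ = mk⤖ (toTree-injective , toTree-surjective)
  where open Bijection k
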